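{- Let $h$ be the morphism on $\{0,1,2,3\}^*$ defined by $h(0)=01213012$, $h(1)=31$, $h(2)=01201312$, $h(3)=0121301312$, let $h^\omega(0)$ be its infinite fixed point starting with $0$, and let $g:\{0,1,2,3\}^*\to\{0,1,2\}^*$ be the morphism defined by $g(0)=0102012$, $g(1)=0212$, $g(2)=0121012$, $g(3)=01020121012$. Then the critical exponent of the infinite word $g(h^\omega(0))$ equals $\tfrac{41}{22}$.
   Context: For a nonempty finite word $u$ and a rational $e$, a word $v$ is the $e$-power $u^e$ of $u$ if $v$ is a prefix of the infinite periodic word $uuu\cdots$ and $e=|v|/|u|$. The critical exponent of an infinite word $\mathbf u$ is $E(\mathbf u)=\sup\{e\in\mathbb Q:\ v^e \text{ is a factor of } \mathbf u \text{ for some nonempty word } v\}$. Morphisms extend to infinite words by letterwise application and concatenation; $h^\omega(0)=\lim_{n\to\infty}h^n(0)$. -}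

module Defs where

open import Data.Fin.Base using (Fin; fromℕ<)
open import Data.Fin.Patterns using (0F; 1F; 2F; 3F)
open import Data.Integer.Base using (+_)
open import Data.List.Base using (List; []; _∷_; _++_; [_]; length; lookup; concatMap; applyUpTo)
open import Data.List.NonEmpty.Base as List⁺ using (List⁺; _∷_; toList)
open import Data.List.Properties using (length-++; ++-assoc; ++-identityʳ; concatMap-++)
open import Data.Nat.Base as ℕ using (ℕ; zero; suc; z≤n; s≤s)
open import Data.Nat.GeneralisedArithmetic using (fold)
import Data.Nat.Properties as ℕ
open import Data.Product.Base using (∃-syntax; _×_; _,_)
open import Data.Rational.Base using (ℚ; _/_; _≤_)
open import Function.Base using (_∘_; const)
open import Relation.Binary.PropositionalEquality
  using (_≡_; refl; sym; trans; cong; cong₂)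
open import Relation.Unary using (Pred)
open import Level using (0ℓ)

private
  variable
    A B : Set

InfWord : Set → Set
InfWord A = ℕ → A

IsPrefix : List A → InfWord A → Set
IsPrefix v w = v ≡ applyUpTo w (length v)

IsFactor : List A → InfWord A → Set
IsFactor v w = ∃[ i ] IsPrefix v (λ j → w (i ℕ.+ j))

-- The infinite concatenation s 0 · s 1 · s 2 · ⋯
concat∞ : (ℕ → List⁺ A) → InfWord A
concat∞ = go []
  module Concat∞ where
  -- go xs s  is  xs · s 0 · s 1 · ⋯
  go : List A → (ℕ → List⁺ A) → InfWord A
  go []       s zero    = List⁺.head (s 0)
  go []       s (suc n) = go (List⁺.tail (s 0)) (s ∘ suc) n
  go (x ∷ xs) s zero    = x
  go (x ∷ xs) s (suc n) = go xs s n

_^∞ : List⁺ A → InfWord A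
u ^∞ = concat∞ (const u)

-- A limit in the product topology: every finite prefix of w is
-- eventually a prefix of the words in the sequence.
_IsLimitOf_ : InfWord A → (ℕ → List A) → Set
w IsLimitOf ws = ∀ k → ∃[ N ] ∀ n → N ℕ.≤ n → ∃[ zs ] ws n ≡ applyUpTo w k ++ zs

-- A morphism of free monoids is given by the images of the letters.  All
-- images are taken to be nonempty, so that the morphism also acts on
-- infinite words.
Morphism : Set → Set → Set
Morphism A B = A → List⁺ B

_⟨_⟩ : Morphism A B → List A → List B
f ⟨ v ⟩ = concatMap (toList ∘ f) v

_⟨_⟩∞ : Morphism A B → InfWord A → InfWord B
f ⟨ w ⟩∞ = concat∞ (f ∘ w)

iterates : Morphism A A → A → ℕ → List A
iterates f a = fold [ a ] (f ⟨_⟩)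

-- The condition f(a) = a x with x nonempty, under which the limit of the
-- words fⁿ(a) exists.
Prolongable : Morphism A A → A → Set
Prolongable f a = ∃[ x ] f a ≡ a ∷ toList x

module _ (f : Morphism A A) (a : A) (prolongable : Prolongable f a) where

  private
    ⟨⟩-nonempty : (v : List⁺ A) → ∃[ v′ ] f ⟨ toList v ⟩ ≡ toList v′
    ⟨⟩-nonempty (b ∷ bs) = List⁺.head (f b) ∷ (List⁺.tail (f b) ++ f ⟨ bs ⟩) , refl

    step : ∀ n → ∃[ v ] iterates f a (suc n) ≡ iterates f a n ++ toList v
    step zero = let x , eq = prolongable in x , trans (++-identityʳ _) (cong toList eq)
    step (suc n) with v , eq ← step n with v′ , eq′ ← ⟨⟩-nonempty v =
      v′ , trans (cong (f ⟨_⟩) eq)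
             (trans (concatMap-++ (toList ∘ f) (iterates f a n) (toList v))
                    (cong (f ⟨ iterates f a n ⟩ ++_) eq′))

    extends : ∀ {m n} → m ℕ.≤′ n → ∃[ zs ] iterates f a n ≡ iterates f a m ++ zs
    extends ℕ.≤′-refl = [] , sym (++-identityʳ _)
    extends {m} (ℕ.≤′-step {n} m≤n) with zs , eq ← extends m≤n with v , eq′ ← step n =
      zs ++ toList v , trans eq′ (trans (cong (_++ toList v) eq) (++-assoc (iterates f a m) zs (toList v)))

    nth-++ : ∀ {i} (us zs ws : List A) → ws ≡ us ++ zs →
             (p : i ℕ.< length us) (q : i ℕ.< length ws) →
             lookup us (fromℕ< p) ≡ lookup ws (fromℕ< q)
    nth-++ {zero}  (u ∷ us) zs _ refl p q = refl
    nth-++ {suc i} (u ∷ us) zs _ refl p q = nth-++ us zs _ refl (ℕ.s<s⁻¹ p) (ℕ.s<s⁻¹ q)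

    applyUpTo-lookup : ∀ k (w : InfWord A) (us : List A) → k ℕ.≤ length us →
                       (∀ i → i ℕ.< k → (p : i ℕ.< length us) → w i ≡ lookup us (fromℕ< p)) →
                       ∃[ zs ] us ≡ applyUpTo w k ++ zs
    applyUpTo-lookup zero    w us       _  _  = us , refl
    applyUpTo-lookup (suc k) w (u ∷ us) (s≤s k≤) eq
      with zs , eq′ ← applyUpTo-lookup k (w ∘ suc) us k≤
                        (λ i i<k p → eq (suc i) (s≤s i<k) (s≤s p)) =
      zs , cong₂ _∷_ (sym (eq 0 (s≤s z≤n) (s≤s z≤n))) eq′

  iterates-length : ∀ n → n ℕ.< length (iterates f a n)
  iterates-length zero = s≤s z≤n
  iterates-length (suc n) with v , eq ← step n = begin-strict
    suc n                                         ≤⟨ iterates-length n ⟩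
    length (iterates f a n)                       <⟨ ℕ.m<m+n _ (s≤s z≤n) ⟩
    length (iterates f a n) ℕ.+ length (toList v) ≡⟨ length-++ (iterates f a n) ⟨
    length (iterates f a n ++ toList v)           ≡⟨ cong length eq ⟨
    length (iterates f a (suc n))                 ∎
    where open ℕ.≤-Reasoning

  -- f^ω(a) = lim fⁿ(a).  Each fⁿ(a) is a prefix of fⁿ⁺¹(a), so
  -- the letter at position i can be read off from fⁱ(a), which is long enough.
  iterate-limit : InfWord A
  iterate-limit i = lookup (iterates f a i) (fromℕ< (iterates-length i))

  iterate-limit-isLimit : iterate-limit IsLimitOf iterates f a
  iterate-limit-isLimit k = k , λ n k≤n →
    applyUpTo-lookup k iterate-limit (iterates f a n)
      (ℕ.≤-trans k≤n (ℕ.<⇒≤ (iterates-length n)))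
      (λ i i<k p → let zs , eq = extends (ℕ.≤⇒≤′ (ℕ.≤-trans (ℕ.<⇒≤ i<k) k≤n)) in
        nth-++ (iterates f a i) zs (iterates f a n) eq (iterates-length i) p)

-- v = u ^ e
IsPower : List A → List⁺ A → ℚ → Set
IsPower v u e = IsPrefix v (u ^∞) × e ≡ + length v / List⁺.length u

ContainsPower : InfWord A → Pred ℚ 0ℓ
ContainsPower {A} w e = ∃[ u ] ∃[ v ] IsPower {A} v u e × IsFactor v w

-- Testing against rational upper bounds only suffices: ℚ is dense in ℝ, so
-- a rational number is the supremum in ℝ of a set of rationals precisely
-- when it is the least of its rational upper bounds.
IsSupremum : Pred ℚ 0ℓ → ℚ → Set
IsSupremum P s = (∀ e → P e → e ≤ s) × (∀ b → (∀ e → P e → e ≤ b) → s ≤ b)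

IsCriticalExponent : InfWord A → ℚ → Set
IsCriticalExponent w = IsSupremum (ContainsPower w)

h : Morphism (Fin 4) (Fin 4)
h 0F = 0F ∷ 1F ∷ 2F ∷ 1F ∷ 3F ∷ 0F ∷ 1F ∷ 2F ∷ []
h 1F = 3F ∷ 1F ∷ []
h 2F = 0F ∷ 1F ∷ 2F ∷ 0F ∷ 1F ∷ 3F ∷ 1F ∷ 2F ∷ []
h 3F = 0F ∷ 1F ∷ 2F ∷ 1F ∷ 3F ∷ 0F ∷ 1F ∷ 3F ∷ 1F ∷ 2F ∷ []

g : Morphism (Fin 4) (Fin 3)
g 0F = 0F ∷ 1F ∷ 0F ∷ 2F ∷ 0F ∷ 1F ∷ 2F ∷ []
g 1F = 0F ∷ 2F ∷ 1F ∷ 2F ∷ []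
g 2F = 0F ∷ 1F ∷ 2F ∷ 1F ∷ 0F ∷ 1F ∷ 2F ∷ []
g 3F = 0F ∷ 1F ∷ 0F ∷ 2F ∷ 0F ∷ 1F ∷ 2F ∷ 1F ∷ 0F ∷ 1F ∷ 2F ∷ []

h-prolongable : Prolongable h 0F
h-prolongable = _ , refl

h^ω0 : InfWord (Fin 4)
h^ω0 = iterate-limit h 0F h-prolongable

-- A factor of length p + r with period p is a pair of occurrences of a word of
-- length r at distance p, so the claim is that r / p ≤ 19 / 22, with equality
-- for some factor of period 22.  When r is large, the two occurrences contain a
-- block boundary at the same place, hence they can be desubstituted under g, and
-- then repeatedly under h, with a smaller period each time, until r ≤ 12.  The
-- lengths |g(hᵏ(u))| are affine in 6ᵏ, and a repetition in the image of a
-- repetition exceeds this image only by the common prefixes and suffixes of the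
-- images of the two pairs of mismatching letters around it.  Weighting these
-- pairs makes the inequality to be shown invariant under desubstitution, for all
-- k at once, and a finite check of the short repetitions finishes the proof.

{-# OPTIONS --safe #-}

module Submission where

open import Defs
open import Algebra.Properties.CommutativeSemigroup using (interchange)
open import Data.Bool.Base using (Bool; true; false; T; if_then_else_; _∧_)
open import Data.Bool.ListAction using (all)
import Data.Bool.Properties as Bool
open import Data.Empty using (⊥-elim)
open import Data.Fin.Base using (Fin)
open import Data.Fin.Patterns using (0F; 1F; 2F; 3F)
import Data.Fin.Properties as Fin
import Data.Integer.Base as ℤ
import Data.Integer.Properties as ℤ
open import Data.List.Base
  using (List; []; _∷_; [_]; _++_; _ʳ++_; length; drop; take; upTo; applyUpTo; concatMap; foldr)
open import Data.List.Membership.Propositional using (_∈_; find)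
open import Data.List.Membership.Propositional.Properties
  using (∈-applyUpTo⁺; ∈-concatMap⁺; ∈-upTo⁺)
open import Data.List.NonEmpty.Base as List⁺ using (List⁺; _∷_; toList)
open import Data.List.Properties
  using (∷-injective; applyUpTo-∷ʳ; ++-identityʳ; concatMap-++; length-++; length-applyUpTo; length-take)
open import Data.List.Relation.Binary.Prefix.Heterogeneous using (Prefix; []; _∷_)
open import Data.List.Relation.Binary.Prefix.Heterogeneous.Properties using (prefix?)
open import Data.List.Relation.Unary.All as All using (All)
open import Data.List.Relation.Unary.All.Properties using (all⁺)
open import Data.List.Relation.Unary.Any as Any using (Any; here)
open import Data.Nat.Base hiding (_/_)
open import Data.Nat.Induction using (<-rec)
open import Data.Nat.Properties
open import Data.Nat.Tactic.RingSolver using (solve-∀)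
open import Data.Product.Base using (∃₂; ∃-syntax; _×_; _,_; proj₁; proj₂)
import Data.Rational.Base as ℚ
import Data.Rational.Properties as ℚ
import Data.Rational.Unnormalised.Base as ℚᵘ
import Data.Rational.Unnormalised.Properties as ℚᵘ
open import Data.Sum.Base using (_⊎_; inj₁; inj₂)
open import Data.Unit.Base using (⊤; tt)
open import Function.Base using (_∘_; const)
open import Function.Bundles using (Equivalence)
open import Relation.Binary.PropositionalEquality hiding ([_])
open import Relation.Nullary.Decidable using (yes; no; does; toWitness; T?; _⊎-dec_; _×-dec_)
open import Relation.Nullary.Negation using (contradiction)

-- Desubstitution shortens the period but makes the letters heavier: where a letter of the image
-- counts as |g(hᵏ(b))|, a letter of the preimage counts as |g(hᵏ⁺¹(a))|. The induction on the
-- period therefore has to hold for every k at once. With t = (6ᵏ - 1) / 5 the passage from k to k +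
-- 1 is t ↦ 6 t + 1, and functions s t + c are compared coefficient by coefficient, so that one
-- computation settles an inequality for every natural t. Repetitions are not assumed maximal: a
-- maximal one exists only if the agreement at distance p breaks off somewhere, which is not known
-- beforehand. Instead, every place where a repetition may stop is tested, and the weights vanish on
-- pairs of equal letters.

private
  variable
    A B : Set

-- Occurrences of words and repetitions in an infinite word.

Occurs : InfWord A → ℕ → List A → Set
Occurs v i []       = ⊤
Occurs v i (x ∷ xs) = v i ≡ x × Occurs v (suc i) xs

-- The letters before position i, read leftwards, agree with the list as
-- far as both exist.
Precedes : InfWord A → ℕ → List A → Set
Precedes v i       []       = ⊤
Precedes v zero    (x ∷ xs) = ⊤
Precedes v (suc i) (x ∷ xs) = v i ≡ x × Precedes v i xs

occurs-++ : ∀ (v : InfWord A) {i} xs {ys} →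
            Occurs v i xs → Occurs v (i + length xs) ys → Occurs v i (xs ++ ys)
occurs-++ v {i} []       {ys} _        q = subst (λ j → Occurs v j ys) (+-identityʳ i) q
occurs-++ v {i} (x ∷ xs) {ys} (p , ps) q =
  p , occurs-++ v xs ps (subst (λ j → Occurs v j ys) (+-suc i (length xs)) q)

occurs-drop : ∀ (v : InfWord A) {i} k xs → Occurs v i xs → Occurs v (i + k) (drop k xs)
occurs-drop v {i} zero    xs       p       = subst (λ j → Occurs v j xs) (sym (+-identityʳ i)) p
occurs-drop v {i} (suc k) []       p       = tt
occurs-drop v {i} (suc k) (x ∷ xs) (_ , p) =
  subst (λ j → Occurs v j (drop k xs)) (sym (+-suc i k)) (occurs-drop v k xs p)

occurs-take : ∀ (v : InfWord A) {i} k xs → Occurs v i xs → Occurs v i (take k xs)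
occurs-take v zero    xs       p       = tt
occurs-take v (suc k) []       p       = tt
occurs-take v (suc k) (x ∷ xs) (p , q) = p , occurs-take v k xs q

occurs-prefix : ∀ (v : InfWord A) {i xs ys} → Prefix _≡_ xs ys → Occurs v i ys → Occurs v i xs
occurs-prefix v []           _       = tt
occurs-prefix v (refl ∷ pre) (p , q) = p , occurs-prefix v pre q

occurs-agree : ∀ (v : InfWord A) {i j k} xs → Occurs v i xs → Occurs v j xs →
               k < length xs → v (i + k) ≡ v (j + k)
occurs-agree v {i} {j} {zero} (x ∷ xs) (p , _) (q , _) _
  rewrite +-identityʳ i | +-identityʳ j = trans p (sym q)
occurs-agree v {i} {j} {suc k} (x ∷ xs) (_ , p) (_ , q) (s≤s k<)
  rewrite +-suc i k | +-suc j k = occurs-agree v xs p q k<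

occurs-applyUpTo : ∀ (v : InfWord A) i n → Occurs v i (applyUpTo (λ k → v (i + k)) n)
occurs-applyUpTo v i zero    = tt
occurs-applyUpTo v i (suc n)
  rewrite +-identityʳ i = refl , go n (λ k → v (i + suc k)) (λ k → cong v (sym (+-suc i k)))
  where
  go : ∀ {j} n (u : ℕ → _) → (∀ k → v (j + k) ≡ u k) → Occurs v j (applyUpTo u n)
  go         zero    u eq = tt
  go {j = j} (suc n) u eq = trans (cong v (sym (+-identityʳ j))) (eq 0) ,
    go n (u ∘ suc) (λ k → trans (cong v (sym (+-suc j k))) (eq (suc k)))

occurs⇒isPrefix : ∀ (v : InfWord A) {i} xs → Occurs v i xs → IsPrefix xs (λ k → v (i + k))
occurs⇒isPrefix v {i} xs = go xs (λ k → v (i + k)) (λ _ → refl)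
  where
  go : ∀ {j} xs (u : ℕ → _) → (∀ k → v (j + k) ≡ u k) → Occurs v j xs → xs ≡ applyUpTo u (length xs)
  go         []       u eq _       = refl
  go {j = j} (x ∷ xs) u eq (p , q) = cong₂ _∷_
    (trans (sym p) (trans (cong v (sym (+-identityʳ j))) (eq 0)))
    (go xs (u ∘ suc) (λ k → trans (cong v (sym (+-suc j k))) (eq (suc k))) q)

precedes-ʳ++ : ∀ (v : InfWord A) {i} xs {ys} →
               Occurs v i xs → Precedes v i ys → Precedes v (i + length xs) (xs ʳ++ ys)
precedes-ʳ++ v {i} []       {ys} _       q = subst (λ j → Precedes v j ys) (sym (+-identityʳ i)) q
precedes-ʳ++ v {i} (x ∷ xs) {ys} (p , r) q =
  subst (λ j → Precedes v j (xs ʳ++ (x ∷ ys))) (sym (+-suc i (length xs)))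
        (precedes-ʳ++ v xs r (p , q))

Covers : InfWord A → List (List A) → Set
Covers v us = ∀ i → ∃[ u ] u ∈ us × Occurs v i u

-- This describes the factor from `a` to `b + p` with period `p`, whose repeated part has length b -
-- a. Agreement at `b` itself is not excluded.
Repeats : InfWord A → ℕ → ℕ → ℕ → Set
Repeats v a b p = ∀ k → a ≤ k → k < b → v k ≡ v (k + p)

-- Affine functions

Affine : Set
Affine = ℕ × ℕ

eval : ℕ → Affine → ℕ
eval t (s , c) = s * t + c

infixl 6 _⊕_
infixl 7 _⊙_
infix  4 _≤ᴬ_

_⊕_ : Affine → Affine → Affine
(s , c) ⊕ (s′ , c′) = s + s′ , c + c′

_⊙_ : ℕ → Affine → Affine
k ⊙ (s , c) = k * s , k * c

-- Sufficient, not necessary, for the inequality at every natural t; being a boolean, it can be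
-- evaluated in finite checks.
_≤ᴬ_ : Affine → Affine → Bool
(s , c) ≤ᴬ (s′ , c′) = (s ≤ᵇ s′) ∧ (c ≤ᵇ c′)

T-∧ˡ : ∀ {x y} → T (x ∧ y) → T x
T-∧ˡ = proj₁ ∘ Equivalence.to Bool.T-∧

T-∧ʳ : ∀ {x y} → T (x ∧ y) → T y
T-∧ʳ {x} = proj₂ ∘ Equivalence.to (Bool.T-∧ {x})

eval-⊕ : ∀ t x y → eval t (x ⊕ y) ≡ eval t x + eval t y
eval-⊕ t (s , c) (s′ , c′) = begin
  (s + s′) * t + (c + c′)       ≡⟨ cong (_+ (c + c′)) (*-distribʳ-+ t s s′) ⟩
  (s * t + s′ * t) + (c + c′)   ≡⟨ interchange +-commutativeSemigroup (s * t) (s′ * t) c c′ ⟩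
  (s * t + c) + (s′ * t + c′)   ∎
  where
  open ≡-Reasoning

eval-⊙ : ∀ t k x → eval t (k ⊙ x) ≡ k * eval t x
eval-⊙ t k (s , c) = begin
  k * s * t + k * c    ≡⟨ cong (_+ k * c) (*-assoc k s t) ⟩
  k * (s * t) + k * c  ≡⟨ *-distribˡ-+ k (s * t) c ⟨
  k * (s * t + c)      ∎
  where open ≡-Reasoning

eval-mono : ∀ t x y → T (x ≤ᴬ y) → eval t x ≤ eval t y
eval-mono t (s , c) (s′ , c′) x≤y =
  +-mono-≤ (*-monoˡ-≤ t (≤ᵇ⇒≤ s s′ (T-∧ˡ x≤y))) (≤ᵇ⇒≤ c c′ (T-∧ʳ {s ≤ᵇ s′} x≤y))

total : (A → Affine) → List A → Affine
total mass = foldr (λ a → mass a ⊕_) (0 , 0)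

all-lookup : ∀ (f : A → Bool) {x xs} → T (all f xs) → x ∈ xs → T (f x)
all-lookup f {xs = xs} p = All.lookup (all⁺ f xs p)

-- Weighted positions and walks to the first mismatch.

before : (A → A → Affine) → InfWord A → ℕ → ℕ → Affine
before e v zero    p = 0 , 0
before e v (suc a) p = e (v a) (v (a + p))

module _ {n : ℕ} (mass : Fin n → Affine) (e : Fin n → Fin n → Affine) (ok : Affine → Bool) where

  -- Follows two words up to their first mismatch, which must exist, testing ok
  -- on the mass (plus e) of each common prefix; the last test is at the mismatch.
  walk : Affine → List (Fin n) → List (Fin n) → Bool
  walk acc (x ∷ xs) (y ∷ ys) =
    ok (acc ⊕ e x y) ∧ (if does (x Fin.≟ y) then walk (acc ⊕ mass x) xs ys else true)
  walk acc _        _        = false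

  walk-here : ∀ {acc x y xs ys} → T (walk acc (x ∷ xs) (y ∷ ys)) → T (ok (acc ⊕ e x y))
  walk-here = T-∧ˡ

  walk-next : ∀ {acc x y xs ys} → x ≡ y → T (walk acc (x ∷ xs) (y ∷ ys)) → T (walk (acc ⊕ mass x) xs ys)
  walk-next {acc} {x} {y} x≡y w with r ← T-∧ʳ {ok (acc ⊕ e x y)} w | x Fin.≟ y
  ... | yes _  = r
  ... | no x≢y = contradiction x≡y x≢y

module Measure {n : ℕ} (v : InfWord (Fin n)) (mass : Fin n → Affine) (t : ℕ) where

  pos : ℕ → ℕ
  pos zero    = 0
  pos (suc i) = pos i + eval t (mass (v i))

  pos-mono′ : ∀ {i j} → i ≤′ j → pos i ≤ pos j
  pos-mono′ ≤′-refl       = ≤-refl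
  pos-mono′ (≤′-step i≤j) = ≤-trans (pos-mono′ i≤j) (m≤m+n _ _)

  pos-mono : ∀ {i j} → i ≤ j → pos i ≤ pos j
  pos-mono = pos-mono′ ∘ ≤⇒≤′

  pos-occurs : ∀ {i} xs → Occurs v i xs → pos (i + length xs) ≡ pos i + eval t (total mass xs)
  pos-occurs {i} []       _       rewrite +-identityʳ i = sym (+-identityʳ _)
  pos-occurs {i} (x ∷ xs) (p , q) = begin
    pos (i + suc (length xs))                                ≡⟨ cong pos (+-suc i (length xs)) ⟩
    pos (suc i + length xs)                                  ≡⟨ pos-occurs xs q ⟩
    pos i + eval t (mass (v i)) + eval t (total mass xs)     ≡⟨ cong (λ z → pos i + eval t (mass z) + _) p ⟩
    pos i + eval t (mass x) + eval t (total mass xs)         ≡⟨ +-assoc (pos i) _ _ ⟩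
    pos i + (eval t (mass x) + eval t (total mass xs))       ≡⟨ cong (pos i +_) (eval-⊕ t (mass x) (total mass xs)) ⟨
    pos i + eval t (total mass (x ∷ xs))                     ∎
    where open ≡-Reasoning

  -- Sliding a window of `p` letters by one step drops `v b` and gains `v (b + p)`, which are equal:
  -- a period has the same mass everywhere in the repetition. Sums on both sides avoid subtraction.
  pos-shift′ : ∀ {a b p} → a ≤′ b → Repeats v a b p → pos (b + p) + pos a ≡ pos (a + p) + pos b
  pos-shift′ ≤′-refl rep = refl
  pos-shift′ {a} {p = p} (≤′-step {b} a≤b) rep = begin
    pos (b + p) + eval t (mass (v (b + p))) + pos a  ≡⟨ cong (λ x → pos (b + p) + eval t (mass x) + pos a) (rep b (≤′⇒≤ a≤b) ≤-refl) ⟨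
    pos (b + p) + μ + pos a                          ≡⟨ +-assoc (pos (b + p)) μ (pos a) ⟩
    pos (b + p) + (μ + pos a)                        ≡⟨ cong (pos (b + p) +_) (+-comm μ (pos a)) ⟩
    pos (b + p) + (pos a + μ)                        ≡⟨ +-assoc (pos (b + p)) (pos a) μ ⟨
    pos (b + p) + pos a + μ                          ≡⟨ cong (_+ μ) (pos-shift′ a≤b (λ k a≤k k<b → rep k a≤k (m<n⇒m<1+n k<b))) ⟩
    pos (a + p) + pos b + μ                          ≡⟨ +-assoc (pos (a + p)) (pos b) μ ⟩
    pos (a + p) + (pos b + μ)                        ∎
    where
    open ≡-Reasoning
    μ : ℕ
    μ = eval t (mass (v b))

  pos-shift : ∀ {a b p} → a ≤ b → Repeats v a b p → pos (b + p) + pos a ≡ pos (a + p) + pos b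
  pos-shift = pos-shift′ ∘ ≤⇒≤′

  -- A successful `walk` has met a mismatch among the known letters, and the repetition cannot run
  -- past it, so `b` is reached before the lists end. It may be reached earlier than the mismatch,
  -- because `walk` tests `ok` at every step.
  walk-right : ∀ e ok {m acc s b p} xs ys → Occurs v s xs → Occurs v (s + p) ys →
               s ≤ b → Repeats v s b p → pos s ≡ m + eval t acc → T (walk mass e ok acc xs ys) →
               ∃[ x ] T (ok x) × pos b + eval t (e (v b) (v (b + p))) ≡ m + eval t x
  walk-right e ok {m} {acc} {s} {b} {p} (x ∷ xs) (y ∷ ys) (ox , oxs) (oy , oys) s≤b rep eq w
    with m≤n⇒m<n∨m≡n s≤b
  ... | inj₂ refl = acc ⊕ e x y , walk-here mass e ok {acc} {x} {y} {xs} {ys} w , (begin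
    pos s + eval t (e (v s) (v (s + p)))   ≡⟨ cong₂ (λ a z → a + eval t (e (v s) z)) eq oy ⟩
    m + eval t acc + eval t (e (v s) y)    ≡⟨ cong (λ z → m + eval t acc + eval t (e z y)) ox ⟩
    m + eval t acc + eval t (e x y)        ≡⟨ +-assoc m _ _ ⟩
    m + (eval t acc + eval t (e x y))      ≡⟨ cong (m +_) (eval-⊕ t acc (e x y)) ⟨
    m + eval t (acc ⊕ e x y)               ∎)
    where open ≡-Reasoning
  ... | inj₁ s<b = walk-right e ok {m} xs ys oxs oys s<b
    (λ k s<k → rep k (<⇒≤ s<k))
    (begin
      pos s + eval t (mass (v s))         ≡⟨ cong₂ (λ a z → a + eval t (mass z)) eq ox ⟩
      m + eval t acc + eval t (mass x)    ≡⟨ +-assoc m _ _ ⟩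
      m + (eval t acc + eval t (mass x))  ≡⟨ cong (m +_) (eval-⊕ t acc (mass x)) ⟨
      m + eval t (acc ⊕ mass x)           ∎)
    (walk-next mass e ok {acc} {x} {y} {xs} {ys} (trans (sym ox) (trans (rep s ≤-refl s<b) oy)) w)
    where open ≡-Reasoning

  -- The mirror image of `walk-right`, with an inequality because of position 0: there `before` is
  -- 0, although the walk has charged `e x y`.
  walk-left : ∀ e ok {m acc s a p} xs ys → Precedes v s xs → Precedes v (s + p) ys →
              a ≤ s → Repeats v a s p → m ≡ pos s + eval t acc → T (walk mass e ok acc xs ys) →
              ∃[ x ] T (ok x) × m + eval t (before e v a p) ≤ pos a + eval t x
  walk-left e ok {m} {acc} {zero} {zero} {p} (x ∷ xs) (y ∷ ys) _ _ _ _ eq w =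
    acc ⊕ e x y , walk-here mass e ok {acc} {x} {y} {xs} {ys} w , (begin
      m + 0                         ≡⟨ +-identityʳ m ⟩
      m                             ≡⟨ eq ⟩
      eval t acc                    ≤⟨ m≤m+n _ _ ⟩
      eval t acc + eval t (e x y)   ≡⟨ eval-⊕ t acc (e x y) ⟨
      eval t (acc ⊕ e x y)          ∎)
    where open ≤-Reasoning
  walk-left e ok {m} {acc} {suc s} {a} {p} (x ∷ xs) (y ∷ ys) (ox , oxs) (oy , oys) a≤s rep eq w
    with m≤n⇒m<n∨m≡n a≤s
  ... | inj₂ refl = acc ⊕ e x y , walk-here mass e ok {acc} {x} {y} {xs} {ys} w , ≤-reflexive (begin
    m + eval t (e (v s) (v (s + p)))                  ≡⟨ cong₂ (λ a z → a + eval t (e (v s) z)) eq oy ⟩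
    pos (suc s) + eval t acc + eval t (e (v s) y)     ≡⟨ cong (λ z → pos (suc s) + eval t acc + eval t (e z y)) ox ⟩
    pos (suc s) + eval t acc + eval t (e x y)         ≡⟨ +-assoc (pos (suc s)) _ _ ⟩
    pos (suc s) + (eval t acc + eval t (e x y))       ≡⟨ cong (pos (suc s) +_) (eval-⊕ t acc (e x y)) ⟨
    pos (suc s) + eval t (acc ⊕ e x y)                ∎)
    where open ≡-Reasoning
  ... | inj₁ (s≤s a≤s′) = walk-left e ok {m} xs ys oxs oys a≤s′
    (λ k a≤k k<s → rep k a≤k (m<n⇒m<1+n k<s))
    (begin
      m                                            ≡⟨ eq ⟩
      pos s + eval t (mass (v s)) + eval t acc     ≡⟨ +-assoc (pos s) _ _ ⟩
      pos s + (eval t (mass (v s)) + eval t acc)   ≡⟨ cong (pos s +_) (+-comm _ (eval t acc)) ⟩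
      pos s + (eval t acc + eval t (mass (v s)))   ≡⟨ cong (λ z → pos s + (eval t acc + eval t (mass z))) ox ⟩
      pos s + (eval t acc + eval t (mass x))       ≡⟨ cong (pos s +_) (eval-⊕ t acc (mass x)) ⟨
      pos s + eval t (acc ⊕ mass x)                ∎)
    (walk-next mass e ok {acc} {x} {y} {xs} {ys} (trans (sym ox) (trans (rep s a≤s′ ≤-refl) oy)) w)
    where open ≡-Reasoning

-- For a ≠ b, right a b bounds the amount by which the image of a repetition that
-- is followed by the mismatch (a , b) extends beyond the image of its letters;
-- left a b is the same for a mismatch before the repetition.
record Weights (n : ℕ) : Set where
  field
    mass            : Fin n → Affine
    right left      : Fin n → Fin n → Affine
    right-diagonal  : ∀ a → right a a ≡ (0 , 0)
    left-diagonal   : ∀ a → left a a ≡ (0 , 0)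

module Bounds {n : ℕ} (v : InfWord (Fin n)) (W : Weights n) where

  open Weights W
  open Measure v mass

  excess : ℕ → ℕ → ℕ → ℕ → ℕ
  excess t a b p = eval t (right (v b) (v (b + p))) + eval t (before left v a p)

  -- This is r / p ≤ 19 / 22 with weighted lengths and with the excess added to r. The weighted
  -- period `d` is given by an equation, so that no subtraction of naturals occurs.
  Bounded : ℕ → ℕ → ℕ → ℕ → Set
  Bounded t a b p = ∀ d → pos t (a + p) ≡ pos t a + d →
                    22 * (pos t b + excess t a b p) ≤ 22 * pos t a + 19 * d

-- Finite check of short repetitions.

module ShortFactors {n : ℕ} (W : Weights n) (rightMax leftMax : Affine)
  (right≤ : ∀ x y → T (Weights.right W x y ≤ᴬ rightMax))
  (left≤  : ∀ x y → T (Weights.left W x y ≤ᴬ leftMax)) (r q : ℕ) where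

  open Weights W

  within : Fin n → Fin n → List (Fin n) → Affine → Bool
  within l l′ zs x = 22 ⊙ (x ⊕ left l l′) ≤ᴬ 19 ⊙ total mass zs

  boundedAt : Fin n → List (Fin n) → ℕ → Bool
  -- With the preceding letter in front, dropping `p` letters leads to position a + p - 1: the head
  -- `l′` faces `l`, and the tail is compared with `ys`.
  boundedAt l ys p with drop p (l ∷ ys)
  ... | []       = false
  ... | l′ ∷ ys′ = walk mass right (within l l′ (take p ys)) (0 , 0) ys ys′

  -- Periods beyond `q` need no comparison of letters: `r` letters with the largest weights on both
  -- sides stay within 19/22 of the mass of the first q + 1 letters.
  boundedBeyond : List (Fin n) → Bool
  boundedBeyond ys =
    (q <ᵇ length ys) ∧
    (22 ⊙ (total mass (take r ys) ⊕ rightMax ⊕ leftMax) ≤ᴬ 19 ⊙ total mass (take (suc q) ys))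

  boundedShort : List (Fin n) → Bool
  boundedShort []       = false
  boundedShort (l ∷ ys) = all (boundedAt l ys) (applyUpTo suc q) ∧ boundedBeyond ys

  module _ (r≤q : r ≤ q) (v : InfWord (Fin n)) (t : ℕ) where

    open Measure v mass t
    open Bounds v W

    before≤ : ∀ a p → eval t (before left v a p) ≤ eval t leftMax
    before≤ zero    p = z≤n
    before≤ (suc a) p = eval-mono t (left (v a) (v (a + p))) leftMax (left≤ _ _)

    before-left : ∀ {a p l l′} → Precedes v a [ l ] → v (a + p) ≡ l′ →
                  eval t (before left v a (suc p)) ≤ eval t (left l l′)
    before-left {zero}          _          _  = z≤n
    before-left {suc a} {p} (refl , _) eq =
      ≤-reflexive (cong (λ z → eval t (left (v a) z)) (trans (cong v (+-suc a p)) eq))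

    pos-take : ∀ {a} k ys → Occurs v a ys → k ≤ length ys →
               pos (a + k) ≡ pos a + eval t (total mass (take k ys))
    pos-take {a} k ys occ k≤ = trans
      (cong (λ z → pos (a + z)) (sym (trans (length-take k ys) (m≤n⇒m⊓n≡m k≤))))
      (pos-occurs (take k ys) (occurs-take v k ys occ))

    bounded-at : ∀ {a b p l ys} → a ≤ b → Repeats v a b p → 0 < p → p ≤ length ys →
                 Precedes v a [ l ] → Occurs v a ys → T (boundedAt l ys p) → Bounded t a b p
    bounded-at {a} {b} {suc p} {l} {ys} a≤b rep _ p≤ pre occ ok d pos≡
      with drop p ys | occurs-drop v p ys occ
    ... | l′ ∷ ys′ | occ-l , occ′ with walk-right right (within l l′ (take (suc p) ys)) {pos a} {0 , 0} ys ys′ occ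
            (subst (λ z → Occurs v z ys′) (sym (+-suc a p)) occ′) a≤b rep (sym (+-identityʳ _)) ok
    ... | x , ok-x , eq = begin
      22 * (pos b + (R + L))                                ≡⟨ cong (22 *_) (+-assoc (pos b) R L) ⟨
      22 * (pos b + R + L)                                  ≡⟨ cong (λ z → 22 * (z + L)) eq ⟩
      22 * (pos a + eval t x + L)                           ≤⟨ *-monoʳ-≤ 22 (+-monoʳ-≤ (pos a + eval t x) (before-left pre occ-l)) ⟩
      22 * (pos a + eval t x + eval t (left l l′))          ≡⟨ cong (22 *_) (+-assoc (pos a) _ _) ⟩
      22 * (pos a + (eval t x + eval t (left l l′)))        ≡⟨ cong (λ z → 22 * (pos a + z)) (eval-⊕ t x (left l l′)) ⟨
      22 * (pos a + eval t (x ⊕ left l l′))                 ≡⟨ *-distribˡ-+ 22 (pos a) _ ⟩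
      22 * pos a + 22 * eval t (x ⊕ left l l′)              ≡⟨ cong (22 * pos a +_) (eval-⊙ t 22 (x ⊕ left l l′)) ⟨
      22 * pos a + eval t (22 ⊙ (x ⊕ left l l′))            ≤⟨ +-monoʳ-≤ (22 * pos a) (eval-mono t (22 ⊙ (x ⊕ left l l′)) (19 ⊙ Z) ok-x) ⟩
      22 * pos a + eval t (19 ⊙ Z)                          ≡⟨ cong (22 * pos a +_) (eval-⊙ t 19 Z) ⟩
      22 * pos a + 19 * eval t Z                            ≡⟨ cong (λ z → 22 * pos a + 19 * z) Z≡d ⟩
      22 * pos a + 19 * d                                   ∎
      where
      open ≤-Reasoning
      R L : ℕ
      R = eval t (right (v b) (v (b + suc p)))
      L = eval t (before left v a (suc p))
      Z : Affine
      Z = total mass (take (suc p) ys)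
      Z≡d : eval t Z ≡ d
      Z≡d = +-cancelˡ-≡ (pos a) _ _ (trans (sym (pos-take (suc p) ys occ p≤)) pos≡)

    bounded-beyond : ∀ {a b p ys} → b ≤ a + r → q < p → Occurs v a ys →
                     T (boundedBeyond ys) → Bounded t a b p
    bounded-beyond {a} {b} {p} {ys} b≤ q<p occ ok d pos≡ = begin
      22 * (pos b + (R + L))
        ≤⟨ *-monoʳ-≤ 22 (+-mono-≤ (pos-mono b≤) (+-mono-≤ (eval-mono t (right (v b) (v (b + p))) rightMax (right≤ _ _)) (before≤ a p))) ⟩
      22 * (pos (a + r) + (eval t rightMax + eval t leftMax))
        ≡⟨ cong (λ z → 22 * (z + (eval t rightMax + eval t leftMax))) (pos-take r ys occ (≤-trans r≤q (<⇒≤ q<len))) ⟩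
      22 * (pos a + eval t X + (eval t rightMax + eval t leftMax))
        ≡⟨ cong (22 *_) (+-assoc (pos a) _ _) ⟩
      22 * (pos a + (eval t X + (eval t rightMax + eval t leftMax)))
        ≡⟨ cong (λ z → 22 * (pos a + z)) (+-assoc (eval t X) _ _) ⟨
      22 * (pos a + (eval t X + eval t rightMax + eval t leftMax))
        ≡⟨ cong (λ z → 22 * (pos a + (z + eval t leftMax))) (eval-⊕ t X rightMax) ⟨
      22 * (pos a + (eval t (X ⊕ rightMax) + eval t leftMax))
        ≡⟨ cong (λ z → 22 * (pos a + z)) (eval-⊕ t (X ⊕ rightMax) leftMax) ⟨
      22 * (pos a + eval t (X ⊕ rightMax ⊕ leftMax))
        ≡⟨ *-distribˡ-+ 22 (pos a) _ ⟩
      22 * pos a + 22 * eval t (X ⊕ rightMax ⊕ leftMax)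
        ≡⟨ cong (22 * pos a +_) (eval-⊙ t 22 (X ⊕ rightMax ⊕ leftMax)) ⟨
      22 * pos a + eval t (22 ⊙ (X ⊕ rightMax ⊕ leftMax))
        ≤⟨ +-monoʳ-≤ (22 * pos a) (eval-mono t (22 ⊙ (X ⊕ rightMax ⊕ leftMax)) (19 ⊙ Z) (T-∧ʳ {q <ᵇ length ys} ok)) ⟩
      22 * pos a + eval t (19 ⊙ Z)
        ≡⟨ cong (22 * pos a +_) (eval-⊙ t 19 Z) ⟩
      22 * pos a + 19 * eval t Z
        ≤⟨ +-monoʳ-≤ (22 * pos a) (*-monoʳ-≤ 19 Z≤d) ⟩
      22 * pos a + 19 * d ∎
      where
      open ≤-Reasoning
      R L : ℕ
      R = eval t (right (v b) (v (b + p)))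
      L = eval t (before left v a p)
      X Z : Affine
      X = total mass (take r ys)
      Z = total mass (take (suc q) ys)
      q<len : q < length ys
      q<len = <ᵇ⇒< q (length ys) (T-∧ˡ ok)
      Z≤d : eval t Z ≤ d
      Z≤d = +-cancelˡ-≤ (pos a) _ _ (begin
        pos a + eval t Z   ≡⟨ pos-take (suc q) ys occ q<len ⟨
        pos (a + suc q)    ≤⟨ pos-mono (+-monoʳ-≤ a q<p) ⟩
        pos (a + p)        ≡⟨ pos≡ ⟩
        pos a + d          ∎)

    bounded-short : ∀ {a b p l ys} → a ≤ b → b ≤ a + r → Repeats v a b p → 0 < p →
                    Precedes v a [ l ] → Occurs v a ys → T (boundedShort (l ∷ ys)) → Bounded t a b p
    bounded-short {p = suc p} {l} {ys} a≤b b≤ rep 0<p pre occ ok with suc p ≤? q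
    ... | yes p<q = bounded-at a≤b rep 0<p
            (≤-trans p<q (<⇒≤ (<ᵇ⇒< q (length ys) (T-∧ˡ (T-∧ʳ {all (boundedAt l ys) (applyUpTo suc q)} ok)))))
            pre occ (all-lookup (boundedAt l ys) (T-∧ˡ ok) (∈-applyUpTo⁺ suc p<q))
    ... | no p≮q = bounded-beyond b≤ (≰⇒> p≮q) occ (T-∧ʳ {all (boundedAt l ys) (applyUpTo suc q)} ok)

    -- Position 0 is treated apart, since no letter precedes it: a prefix of `v` is checked with an
    -- arbitrary letter `l` in front, which is sound because `before` is 0 there.
    bounded-covered : ∀ {uss l ys} → Covers v uss → T (all boundedShort uss) →
                      Occurs v 0 ys → T (boundedShort (l ∷ ys)) →
                      ∀ {a b p} → a ≤ b → b ≤ a + r → Repeats v a b p → 0 < p → Bounded t a b p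
    bounded-covered {l = l} _ _ occ ok {zero} a≤b b≤ rep 0<p =
      bounded-short {l = l} a≤b b≤ rep 0<p tt occ ok
    bounded-covered covers ok _ _ {suc a} a≤b b≤ rep 0<p with covers a
    ... | []     , u∈ , _          = ⊥-elim (all-lookup boundedShort ok u∈)
    ... | l ∷ ys , u∈ , (eq , occ) =
      bounded-short {l = l} a≤b b≤ rep 0<p (eq , tt) occ (all-lookup boundedShort ok u∈)

-- Blocks of an image and their boundaries.

∣_∣ : List⁺ A → ℕ
∣ u ∣ = length (toList u)

cut : Morphism A B → InfWord A → ℕ → ℕ
cut f w zero    = 0
cut f w (suc i) = cut f w i + ∣ f (w i) ∣

-- One word for each offset in the first block, because a position of the image is given by a block
-- and an offset in it.
expandWord : Morphism A B → List A → List (List B)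
expandWord f []       = [ [] ]
expandWord f (a ∷ us) = applyUpTo (λ k → drop k (f ⟨ a ∷ us ⟩)) ∣ f a ∣

expand : Morphism A B → List (List A) → List (List B)
expand f = concatMap (expandWord f)

module Image {A B : Set} (f : Morphism A B) (w : InfWord A) (v : InfWord B)
  (image : ∀ i → Occurs v (cut f w i) (toList (f (w i)))) where

  cut-< : ∀ i → cut f w i < cut f w (suc i)
  cut-< i = m<m+n (cut f w i) z<s

  cut-mono′ : ∀ {i j} → i ≤′ j → cut f w i ≤ cut f w j
  cut-mono′ ≤′-refl       = ≤-refl
  cut-mono′ (≤′-step i≤j) = ≤-trans (cut-mono′ i≤j) (m≤m+n _ _)

  cut-mono : ∀ {i j} → i ≤ j → cut f w i ≤ cut f w j
  cut-mono = cut-mono′ ∘ ≤⇒≤′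

  cut-cancel-< : ∀ {i j} → cut f w i < cut f w j → i < j
  cut-cancel-< {i} {j} c<c with suc i ≤? j
  ... | yes i<j = i<j
  ... | no  i≮j = contradiction c<c (≤⇒≯ (cut-mono (≤-pred (≰⇒> i≮j))))

  locate : ∀ k → ∃₂ λ i s → s < ∣ f (w i) ∣ × k ≡ cut f w i + s
  locate zero = 0 , 0 , z<s , refl
  locate (suc k) with i , s , s< , eq ← locate k with m≤n⇒m<n∨m≡n s<
  ... | inj₁ ss< = i , suc s , ss< , trans (cong suc eq) (sym (+-suc (cut f w i) s))
  ... | inj₂ ss≡ = suc i , 0 , z<s , (begin
    suc k                         ≡⟨ cong suc eq ⟩
    suc (cut f w i + s)           ≡⟨ +-suc (cut f w i) s ⟨
    cut f w i + suc s             ≡⟨ cong (cut f w i +_) ss≡ ⟩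
    cut f w (suc i)               ≡⟨ +-identityʳ _ ⟨
    cut f w (suc i) + 0           ∎)
    where open ≡-Reasoning

  occurs-image : ∀ {i} us → Occurs w i us → Occurs v (cut f w i) (f ⟨ us ⟩)
  occurs-image     []       _          = tt
  occurs-image {i} (a ∷ us) (refl , p) = occurs-++ v (toList (f a)) (image i) (occurs-image us p)

  occurs-expand : ∀ {i s} us → Occurs w i us → s < ∣ f (w i) ∣ →
                  ∃[ x ] x ∈ expandWord f us × Occurs v (cut f w i + s) x
  occurs-expand     []       _          _  = [] , here refl , tt
  occurs-expand {s = s} (a ∷ us) (refl , p) s< =
    _ , ∈-applyUpTo⁺ (λ k → drop k (f ⟨ a ∷ us ⟩)) s< ,
    occurs-drop v s (f ⟨ a ∷ us ⟩) (occurs-image (a ∷ us) (refl , p))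

  covers-expand : ∀ {uss} → Covers w uss → Covers v (expand f uss)
  covers-expand cov k with i , s , s< , refl ← locate k with us , us∈ , occ ← cov i
    with x , x∈ , occ′ ← occurs-expand us occ s<
    = x , ∈-concatMap⁺ (expandWord f) (Any.map (λ { refl → x∈ }) us∈) , occ′

  same-block : ∀ {i q p k} → w i ≡ w (i + q) → cut f w (i + q) ≡ cut f w i + p →
               cut f w i ≤ k → k < cut f w (suc i) → v k ≡ v (k + p)
  same-block {i} {q} {p} {k} w≡ cut≡ c≤k k<c = begin
    v k                            ≡⟨ cong v (m+[n∸m]≡n c≤k) ⟨
    v (cut f w i + s)              ≡⟨ occurs-agree v (toList (f (w i))) (image i) occ s< ⟩
    v (cut f w (i + q) + s)        ≡⟨ cong (λ z → v (z + s)) cut≡ ⟩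
    v (cut f w i + p + s)          ≡⟨ cong v (+-assoc (cut f w i) p s) ⟩
    v (cut f w i + (p + s))        ≡⟨ cong (λ z → v (cut f w i + z)) (+-comm p s) ⟩
    v (cut f w i + (s + p))        ≡⟨ cong v (+-assoc (cut f w i) s p) ⟨
    v (cut f w i + s + p)          ≡⟨ cong (λ z → v (z + p)) (m+[n∸m]≡n c≤k) ⟩
    v (k + p)                      ∎
    where
    open ≡-Reasoning
    s : ℕ
    s = k ∸ cut f w i
    s< : s < ∣ f (w i) ∣
    s< = +-cancelˡ-< (cut f w i) _ _ (subst (_< cut f w (suc i)) (sym (m+[n∸m]≡n c≤k)) k<c)
    occ : Occurs v (cut f w (i + q)) (toList (f (w i)))
    occ = subst (λ a → Occurs v (cut f w (i + q)) (toList (f a))) (sym w≡) (image (i + q))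

  cut-step : ∀ {i q p} → w i ≡ w (i + q) → cut f w (i + q) ≡ cut f w i + p →
             cut f w (suc i + q) ≡ cut f w (suc i) + p
  cut-step {i} {q} {p} w≡ cut≡ = begin
    cut f w (i + q) + ∣ f (w (i + q)) ∣  ≡⟨ cong₂ (λ c a → c + ∣ f a ∣) cut≡ (sym w≡) ⟩
    cut f w i + p + ∣ f (w i) ∣          ≡⟨ +-assoc (cut f w i) p _ ⟩
    cut f w i + (p + ∣ f (w i) ∣)        ≡⟨ cong (cut f w i +_) (+-comm p _) ⟩
    cut f w i + (∣ f (w i) ∣ + p)        ≡⟨ +-assoc (cut f w i) _ p ⟨
    cut f w (suc i) + p                  ∎
    where open ≡-Reasoning

  cut-unstep : ∀ {i q p} → w i ≡ w (i + q) → cut f w (suc i + q) ≡ cut f w (suc i) + p →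
               cut f w (i + q) ≡ cut f w i + p
  cut-unstep {i} {q} {p} w≡ cut≡ = +-cancelʳ-≡ ∣ f (w i) ∣ _ _ (begin
    cut f w (i + q) + ∣ f (w i) ∣        ≡⟨ cong (λ a → cut f w (i + q) + ∣ f a ∣) w≡ ⟩
    cut f w (suc i + q)                  ≡⟨ cut≡ ⟩
    cut f w i + ∣ f (w i) ∣ + p          ≡⟨ +-assoc (cut f w i) _ p ⟩
    cut f w i + (∣ f (w i) ∣ + p)        ≡⟨ cong (cut f w i +_) (+-comm _ p) ⟩
    cut f w i + (p + ∣ f (w i) ∣)        ≡⟨ +-assoc (cut f w i) p _ ⟨
    cut f w i + p + ∣ f (w i) ∣          ∎)
    where open ≡-Reasoning

-- Cuts are recognised by the letters around them: the four letters from
-- position k on pass the test precisely when k + 1 + o is the end of a block.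
module Synchronisation {m n : ℕ} (f : Morphism (Fin m) (Fin n))
  (test : Fin n → Fin n → Fin n → Fin n → Bool) (o : ℕ) where

  tested : Bool → List (Fin n) → Bool
  tested b (x₀ ∷ x₁ ∷ x₂ ∷ x₃ ∷ _) = does (test x₀ x₁ x₂ x₃ Bool.≟ b)
  tested b _                       = false

  recognised : List (Fin m) → Bool
  recognised []       = false
  recognised (a ∷ us) = all (λ s → tested (s + suc o ≡ᵇ ∣ f a ∣) (drop s (f ⟨ a ∷ us ⟩))) (upTo ∣ f a ∣)

  module _ (w : InfWord (Fin m)) (v : InfWord (Fin n))
    (image : ∀ i → Occurs v (cut f w i) (toList (f (w i))))
    {uss : List (List (Fin m))} (covers : Covers w uss) (ok : T (all recognised uss))
    (ℓ : ℕ) (o< : ∀ a → o < ∣ f a ∣) (≤ℓ : ∀ a → ∣ f a ∣ ≤ ℓ) (o≤3 : o ≤ 3) where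

    open Image f w v image

    testAt : ℕ → Bool
    testAt k = test (v k) (v (1 + k)) (v (2 + k)) (v (3 + k))

    tested-sound : ∀ {b k} xs → Occurs v k xs → T (tested b xs) → testAt k ≡ b
    tested-sound {b} (x₀ ∷ x₁ ∷ x₂ ∷ x₃ ∷ _) (refl , refl , refl , refl , _) t
      with test x₀ x₁ x₂ x₃ Bool.≟ b
    ... | yes eq = eq

    testAt-cut : ∀ i s → s < ∣ f (w i) ∣ → testAt (cut f w i + s) ≡ (s + suc o ≡ᵇ ∣ f (w i) ∣)
    testAt-cut i s s< with covers i
    ... | []     , us∈ , _          = ⊥-elim (all-lookup recognised ok us∈)
    ... | a ∷ us , us∈ , (refl , p) =
      tested-sound (drop s (f ⟨ a ∷ us ⟩)) (occurs-drop v s (f ⟨ a ∷ us ⟩) (occurs-image (a ∷ us) (refl , p)))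
        (all-lookup (λ s → tested (s + suc o ≡ᵇ ∣ f a ∣) (drop s (f ⟨ a ∷ us ⟩)))
                    (all-lookup recognised {xs = uss} ok us∈) (∈-upTo⁺ s<))

    -- A repeated part of length 3 + ℓ contains a whole window that detects the end of a block. The
    -- test sees only the four letters of the window, so the window shifted by `p` passes too and
    -- detects another block end.
    synchronise : ∀ {a b p} → 0 < p → a + (3 + ℓ) ≤ b → Repeats v a b p →
                  ∃₂ λ i q → 0 < q × a ≤ cut f w i × cut f w i ≤ b × cut f w (i + q) ≡ cut f w i + p
    synchronise {a} {b} {p} 0<p a≤b rep
      -- The window for the end of a block starts o + 1 letters before that end. Taking the block
      -- that contains a + o keeps the window from starting before `a`.
      with i , k , k< , eq ← locate (a + o)
      with s , s≡ ← m≤n⇒∃[o]m+o≡n (o< (w i))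
      with j , s′ , s′< , eq′ ← locate (cut f w i + s + p)
      = suc i , j ∸ i , m<n⇒0<n∸m i<j , a≤c , c≤b ,
        trans (cong (cut f w ∘ suc) (m+[n∸m]≡n (<⇒≤ i<j))) cut≡
      where
      open ≤-Reasoning
      c : ℕ
      c = cut f w i
      end : cut f w (suc i) ≡ c + s + suc o
      end = trans (cong (c +_) (trans (sym s≡) (+-comm (suc o) s))) (sym (+-assoc c s (suc o)))
      a≤c+s : a ≤ c + s
      a≤c+s = +-cancelʳ-≤ o a (c + s) (begin
        a + o        ≡⟨ eq ⟩
        c + k        ≤⟨ +-monoʳ-≤ c (s≤s⁻¹ (≤-trans k< (≤-reflexive (sym s≡)))) ⟩
        c + (o + s)  ≡⟨ cong (c +_) (+-comm o s) ⟩
        c + (s + o)  ≡⟨ +-assoc c s o ⟨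
        c + s + o    ∎)
      c+s<a+ℓ : c + s < a + ℓ
      c+s<a+ℓ = +-cancelʳ-≤ o (suc (c + s)) (a + ℓ) (begin
        suc (c + s) + o     ≡⟨ +-suc (c + s) o ⟨
        c + s + suc o       ≡⟨ +-assoc c s (suc o) ⟩
        c + (s + suc o)     ≡⟨ cong (c +_) (trans (+-comm s (suc o)) s≡) ⟩
        c + ∣ f (w i) ∣     ≤⟨ +-mono-≤ (≤-trans (m≤m+n c k) (≤-reflexive (sym eq))) (≤ℓ (w i)) ⟩
        a + o + ℓ           ≡⟨ +-assoc a o ℓ ⟩
        a + (o + ℓ)         ≡⟨ cong (a +_) (+-comm o ℓ) ⟩
        a + (ℓ + o)         ≡⟨ +-assoc a ℓ o ⟨
        a + ℓ + o           ∎)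
      window≤b : 4 + (c + s) ≤ b
      window≤b = begin
        4 + (c + s)   ≤⟨ +-monoʳ-≤ 3 c+s<a+ℓ ⟩
        3 + (a + ℓ)   ≡⟨ +-assoc 3 a ℓ ⟨
        3 + a + ℓ     ≡⟨ cong (_+ ℓ) (+-comm 3 a) ⟩
        a + 3 + ℓ     ≡⟨ +-assoc a 3 ℓ ⟩
        a + (3 + ℓ)   ≤⟨ a≤b ⟩
        b             ∎
      a≤c : a ≤ cut f w (suc i)
      a≤c = begin
        a              ≤⟨ a≤c+s ⟩
        c + s          ≤⟨ m≤m+n (c + s) (suc o) ⟩
        c + s + suc o  ≡⟨ end ⟨
        cut f w (suc i) ∎
      c≤b : cut f w (suc i) ≤ b
      c≤b = begin
        cut f w (suc i) ≡⟨ end ⟩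
        c + s + suc o  ≤⟨ +-monoʳ-≤ (c + s) (s≤s o≤3) ⟩
        c + s + 4      ≡⟨ +-comm (c + s) 4 ⟩
        4 + (c + s)    ≤⟨ window≤b ⟩
        b              ∎
      agree : ∀ x → x < 4 → v (x + (c + s)) ≡ v (x + (c + s) + p)
      agree x x<4 = rep (x + (c + s)) (≤-trans a≤c+s (m≤n+m (c + s) x))
        (≤-trans (+-monoˡ-≤ (c + s) x<4) window≤b)
      testAt≡ : testAt (c + s) ≡ testAt (c + s + p)
      testAt≡ rewrite agree 0 (s≤s z≤n) | agree 1 (s≤s (s≤s z≤n))
                    | agree 2 (s≤s (s≤s (s≤s z≤n))) | agree 3 ≤-refl = refl
      passes : T (s + suc o ≡ᵇ ∣ f (w i) ∣)
      passes = ≡⇒≡ᵇ _ _ (trans (+-comm s (suc o)) s≡)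
      passes′ : T (s′ + suc o ≡ᵇ ∣ f (w j) ∣)
      passes′ = subst T
        (trans (sym (testAt-cut i s (m+n≤o⇒n≤o o (≤-reflexive (trans (+-suc o s) s≡)))))
          (trans testAt≡ (trans (cong testAt eq′) (testAt-cut j s′ s′<))))
        passes
      cut≡ : cut f w (suc j) ≡ cut f w (suc i) + p
      cut≡ = begin-equality
        cut f w j + ∣ f (w j) ∣    ≡⟨ cong (cut f w j +_) (≡ᵇ⇒≡ _ _ passes′) ⟨
        cut f w j + (s′ + suc o)   ≡⟨ +-assoc (cut f w j) s′ (suc o) ⟨
        cut f w j + s′ + suc o     ≡⟨ cong (_+ suc o) eq′ ⟨
        c + s + p + suc o          ≡⟨ +-assoc (c + s) p (suc o) ⟩
        c + s + (p + suc o)        ≡⟨ cong (c + s +_) (+-comm p (suc o)) ⟩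
        c + s + (suc o + p)        ≡⟨ +-assoc (c + s) (suc o) p ⟨
        c + s + suc o + p          ≡⟨ cong (_+ p) end ⟨
        cut f w (suc i) + p        ∎
      i<j : i < j
      i<j = s≤s⁻¹ (cut-cancel-< (begin-strict
        cut f w (suc i)      <⟨ m<m+n _ 0<p ⟩
        cut f w (suc i) + p  ≡⟨ cut≡ ⟨
        cut f w (suc j)      ∎))

-- Desubstitution of repetitions.

module Descent {m n : ℕ} (f : Morphism (Fin m) (Fin n)) (V : Weights n) (W : Weights m)
  (pull : Affine → Affine) (prefix suffix : List (Fin n)) where

  private
    module V = Weights V
    module W = Weights W

  -- A mismatch of `a` and `b` in the preimage becomes one inside or next to their images. The mass
  -- gained up to there, together with the weight of the new mismatch, has to be paid by the weight
  -- of the old one, read at the parameter of the image.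
  dominated : Fin m → Fin m → Bool
  dominated a b =
    walk V.mass V.right (_≤ᴬ pull (W.right a b)) (0 , 0) (toList (f a) ++ prefix) (toList (f b) ++ prefix) ∧
    walk V.mass V.left (_≤ᴬ pull (W.left a b)) (0 , 0) (toList (f a) ʳ++ suffix) (toList (f b) ʳ++ suffix)

  module _ (w : InfWord (Fin m)) (v : InfWord (Fin n))
    (image : ∀ i → Occurs v (cut f w i) (toList (f (w i))))
    (t t′ : ℕ) (eval-pull : ∀ x → eval t (pull x) ≡ eval t′ x)
    (total-mass : ∀ a → total V.mass (toList (f a)) ≡ pull (W.mass a))
    (dominates : ∀ a b → a ≢ b → T (dominated a b))
    (followed : ∀ i → Occurs v (cut f w i) prefix)
    (preceded : ∀ i → Precedes v (cut f w i) suffix) where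

    open Image f w v image
    private
      module PV = Measure v V.mass t
      module PW = Measure w W.mass t′
      module BV = Bounds v V
      module BW = Bounds w W

    pos-cut : ∀ i → PV.pos (cut f w i) ≡ PW.pos i
    pos-cut zero    = refl
    pos-cut (suc i) = begin
      PV.pos (cut f w i + ∣ f (w i) ∣)                                   ≡⟨ PV.pos-occurs (toList (f (w i))) (image i) ⟩
      PV.pos (cut f w i) + eval t (total V.mass (toList (f (w i))))      ≡⟨ cong₂ (λ c z → c + eval t z) (pos-cut i) (total-mass (w i)) ⟩
      PW.pos i + eval t (pull (W.mass (w i)))                            ≡⟨ cong (PW.pos i +_) (eval-pull (W.mass (w i))) ⟩
      PW.pos i + eval t′ (W.mass (w i))                                  ∎
      where open ≡-Reasoning

    eval-pull-mono : ∀ x y → T (x ≤ᴬ pull y) → eval t x ≤ eval t′ y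
    eval-pull-mono x y x≤ = ≤-trans (eval-mono t x (pull y) x≤) (≤-reflexive (eval-pull y))

    repeats-single : ∀ {i q} → w i ≡ w (i + q) → Repeats w i (suc i) q
    repeats-single {q = q} w≡ k i≤k k<si =
      subst (λ z → w z ≡ w (z + q)) (≤-antisym i≤k (s≤s⁻¹ k<si)) w≡

    repeats-trans : ∀ {C : Set} (u : InfWord C) {i j k q} → Repeats u i j q → Repeats u j k q → Repeats u i k q
    repeats-trans u {j = j} left right x i≤x x<k with x <? j
    ... | yes x<j = left x i≤x x<j
    ... | no  x≮j = right x (≮⇒≥ x≮j) x<k

    -- The end `b` is approached cut by cut. Equal letters carry the alignment to the next cut; at
    -- different letters, `dominates` pays for the remainder. Blocks are nonempty, so the distance
    -- to `b` is enough fuel.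
    extendʳ : ∀ fuel {i q b p} → cut f w (i + q) ≡ cut f w i + p → cut f w i ≤ b →
              b ≤ fuel + cut f w i → Repeats v (cut f w i) b p →
              ∃[ j ] i ≤ j × Repeats w i j q ×
                PV.pos b + eval t (V.right (v b) (v (b + p))) ≤
                PW.pos j + eval t′ (W.right (w j) (w (j + q)))
    extendʳ fuel {i} {q} {b} {p} cut≡ c≤b b≤ rep with w i Fin.≟ w (i + q)
    ... | no w≢ with PV.walk-right V.right _ {PV.pos (cut f w i)} {0 , 0}
            (toList (f (w i)) ++ prefix) (toList (f (w (i + q))) ++ prefix)
            (occurs-++ v (toList (f (w i))) (image i) (followed (suc i)))
            (subst (λ c → Occurs v c (toList (f (w (i + q))) ++ prefix)) cut≡
              (occurs-++ v (toList (f (w (i + q)))) (image (i + q)) (followed (suc (i + q)))))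
            c≤b rep (sym (+-identityʳ _)) (T-∧ˡ (dominates (w i) (w (i + q)) w≢))
    ...   | x , x≤ , eq = i , ≤-refl , (λ k i≤k k<i → contradiction k<i (≤⇒≯ i≤k)) , (begin
      PV.pos b + eval t (V.right (v b) (v (b + p)))         ≡⟨ eq ⟩
      PV.pos (cut f w i) + eval t x                         ≤⟨ +-mono-≤ (≤-reflexive (pos-cut i)) (eval-pull-mono x _ x≤) ⟩
      PW.pos i + eval t′ (W.right (w i) (w (i + q)))        ∎)
      where open ≤-Reasoning
    extendʳ fuel {i} {q} {b} {p} cut≡ c≤b b≤ rep | yes w≡ with b <? cut f w (suc i)
    -- The repetition stops in a block that still agrees, so `v b` equals `v (b + p)`: the weight is
    -- 0, and rounding up to the next cut suffices.
    ... | yes b<c = suc i , n≤1+n i , repeats-single w≡ , (begin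
      PV.pos b + eval t (V.right (v b) (v (b + p)))         ≡⟨ cong (λ z → PV.pos b + eval t (V.right (v b) z)) (same-block w≡ cut≡ c≤b b<c) ⟨
      PV.pos b + eval t (V.right (v b) (v b))               ≡⟨ cong (λ z → PV.pos b + eval t z) (V.right-diagonal (v b)) ⟩
      PV.pos b + 0                                          ≤⟨ +-mono-≤ (≤-trans (PV.pos-mono (<⇒≤ b<c)) (≤-reflexive (pos-cut (suc i)))) z≤n ⟩
      PW.pos (suc i) + eval t′ (W.right (w (suc i)) (w (suc i + q))) ∎)
      where open ≤-Reasoning
    extendʳ zero {i} cut≡ c≤b b≤ rep | yes w≡ | no b≮c =
      contradiction (≤-<-trans b≤ (cut-< i)) b≮c
    extendʳ (suc fuel) {i} {q} {b} cut≡ c≤b b≤ rep | yes w≡ | no b≮c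
      with extendʳ fuel (cut-step w≡ cut≡) (≮⇒≥ b≮c)
             (≤-trans b≤ (≤-trans (≤-reflexive (sym (+-suc fuel (cut f w i)))) (+-monoʳ-≤ fuel (cut-< i))))
             (λ k c≤k → rep k (≤-trans (<⇒≤ (cut-< i)) c≤k))
    ... | j , i<j , rep′ , bound = j , <⇒≤ i<j , repeats-trans w (repeats-single w≡) rep′ , bound

    extendˡ : ∀ i {q a p} → cut f w (i + q) ≡ cut f w i + p → a ≤ cut f w i → Repeats v a (cut f w i) p →
              ∃[ j ] j ≤ i × Repeats w j i q ×
                PW.pos j + eval t (before V.left v a p) ≤ PV.pos a + eval t′ (before W.left w j q)
    -- Nothing precedes either word here, so both left weights are 0.
    extendˡ zero {a = zero} cut≡ z≤n rep = 0 , z≤n , (λ _ _ ()) , z≤n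
    extendˡ (suc i) {q} {a} {p} cut≡ a≤c rep with w i Fin.≟ w (i + q)
    ... | no w≢ with PV.walk-left V.left _ {PV.pos (cut f w (suc i))} {0 , 0}
            (toList (f (w i)) ʳ++ suffix) (toList (f (w (i + q))) ʳ++ suffix)
            (precedes-ʳ++ v (toList (f (w i))) (image i) (preceded i))
            (subst (λ c → Precedes v c (toList (f (w (i + q))) ʳ++ suffix)) cut≡
              (precedes-ʳ++ v (toList (f (w (i + q)))) (image (i + q)) (preceded (i + q))))
            a≤c rep (sym (+-identityʳ _))
            (T-∧ʳ {walk V.mass V.right (_≤ᴬ pull (W.right (w i) (w (i + q)))) (0 , 0)
                     (toList (f (w i)) ++ prefix) (toList (f (w (i + q))) ++ prefix)}
                  (dominates (w i) (w (i + q)) w≢))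
    ...   | x , x≤ , bound = suc i , ≤-refl , (λ k i≤k k<i → contradiction k<i (≤⇒≯ i≤k)) , (begin
      PW.pos (suc i) + eval t (before V.left v a p)              ≡⟨ cong (_+ _) (pos-cut (suc i)) ⟨
      PV.pos (cut f w (suc i)) + eval t (before V.left v a p)    ≤⟨ bound ⟩
      PV.pos a + eval t x                                        ≤⟨ +-monoʳ-≤ (PV.pos a) (eval-pull-mono x _ x≤) ⟩
      PV.pos a + eval t′ (W.left (w i) (w (i + q)))              ∎)
      where open ≤-Reasoning
    extendˡ (suc i) {q} {a} {p} cut≡ a≤c rep | yes w≡ with a ≤? cut f w i
    ... | yes a≤c′
      with j , j≤i , rep′ , bound ← extendˡ i (cut-unstep w≡ cut≡) a≤c′ (λ k a≤k k<c → rep k a≤k (<-trans k<c (cut-< i)))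
      = j , m≤n⇒m≤1+n j≤i , repeats-trans w rep′ (repeats-single w≡) , bound
    extendˡ (suc i) {q} {zero}  {p} cut≡ a≤c rep | yes w≡ | no a≰c = contradiction z≤n a≰c
    extendˡ (suc i) {q} {suc a} {p} cut≡ a≤c rep | yes w≡ | no a≰c = i , n≤1+n i , repeats-single w≡ , (begin
      PW.pos i + eval t (V.left (v a) (v (a + p)))    ≡⟨ cong (λ z → PW.pos i + eval t (V.left (v a) z))
                                                          (same-block w≡ (cut-unstep w≡ cut≡) (s≤s⁻¹ (≰⇒> a≰c)) a≤c) ⟨
      PW.pos i + eval t (V.left (v a) (v a))          ≡⟨ cong (λ z → PW.pos i + eval t z) (V.left-diagonal (v a)) ⟩
      PW.pos i + 0                                    ≡⟨ cong (_+ 0) (pos-cut i) ⟨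
      PV.pos (cut f w i) + 0                          ≤⟨ +-mono-≤ (PV.pos-mono (<⇒≤ (≰⇒> a≰c))) z≤n ⟩
      PV.pos (suc a) + _                              ∎)
      where open ≤-Reasoning

    -- The period of the repetition is measured at the cut inside it, where v and w can be compared.
    bounded-image : ∀ {a b p i q} → a ≤ cut f w i → cut f w i ≤ b → cut f w (i + q) ≡ cut f w i + p →
                    Repeats v a b p →
                    (∀ {j k} → j ≤ k → Repeats w j k q → BW.Bounded t′ j k q) →
                    BV.Bounded t a b p
    bounded-image {a} {b} {p} {i} {q} a≤c c≤b cut≡ rep bounded d pos≡
      with extendˡ i cut≡ a≤c (λ k a≤k k<c → rep k a≤k (<-≤-trans k<c c≤b))
         | extendʳ (b ∸ cut f w i) cut≡ c≤b (≤-reflexive (sym (m∸n+n≡m c≤b))) (λ k c≤k → rep k (≤-trans a≤c c≤k))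
    ... | j , j≤i , repˡ , boundˡ | k , i≤k , repʳ , boundʳ = +-cancelˡ-≤ (22 * PW.pos j) _ _ (begin
      22 * PW.pos j + 22 * (PV.pos b + (R + L))         ≡⟨ *-distribˡ-+ 22 (PW.pos j) _ ⟨
      22 * (PW.pos j + (PV.pos b + (R + L)))            ≡⟨ cong (22 *_) (shuffle (PW.pos j) (PV.pos b) R L) ⟩
      22 * ((PV.pos b + R) + (PW.pos j + L))            ≤⟨ *-monoʳ-≤ 22 (+-mono-≤ boundʳ boundˡ) ⟩
      22 * ((PW.pos k + R′) + (PV.pos a + L′))          ≡⟨ cong (22 *_) (shuffle′ (PW.pos k) R′ (PV.pos a) L′) ⟩
      22 * ((PW.pos k + (R′ + L′)) + PV.pos a)          ≡⟨ *-distribˡ-+ 22 (PW.pos k + (R′ + L′)) _ ⟩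
      22 * (PW.pos k + (R′ + L′)) + 22 * PV.pos a       ≤⟨ +-monoˡ-≤ (22 * PV.pos a)
                                                              (bounded (≤-trans j≤i i≤k) (repeats-trans w repˡ repʳ) d period) ⟩
      22 * PW.pos j + 19 * d + 22 * PV.pos a            ≡⟨ +-assoc (22 * PW.pos j) _ _ ⟩
      22 * PW.pos j + (19 * d + 22 * PV.pos a)          ≡⟨ cong (22 * PW.pos j +_) (+-comm (19 * d) _) ⟩
      22 * PW.pos j + (22 * PV.pos a + 19 * d)          ∎)
      where
      open ≤-Reasoning
      shuffle : ∀ x y r l → x + (y + (r + l)) ≡ (y + r) + (x + l)
      shuffle = solve-∀
      shuffle′ : ∀ x r y l → (x + r) + (y + l) ≡ (x + (r + l)) + y
      shuffle′ = solve-∀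
      R L R′ L′ : ℕ
      R  = eval t (V.right (v b) (v (b + p)))
      L  = eval t (before V.left v a p)
      R′ = eval t′ (W.right (w k) (w (k + q)))
      L′ = eval t′ (before W.left w j q)
      period′ : PW.pos (i + q) ≡ PW.pos i + d
      period′ = +-cancelʳ-≡ (PV.pos a) _ _ (begin-equality
        PW.pos (i + q) + PV.pos a              ≡⟨ cong (_+ PV.pos a) (pos-cut (i + q)) ⟨
        PV.pos (cut f w (i + q)) + PV.pos a    ≡⟨ cong (λ c → PV.pos c + PV.pos a) cut≡ ⟩
        PV.pos (cut f w i + p) + PV.pos a      ≡⟨ PV.pos-shift a≤c (λ x a≤x x<c → rep x a≤x (<-≤-trans x<c c≤b)) ⟩
        PV.pos (a + p) + PV.pos (cut f w i)    ≡⟨ cong₂ _+_ pos≡ (pos-cut i) ⟩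
        PV.pos a + d + PW.pos i                ≡⟨ +-comm (PV.pos a + d) _ ⟩
        PW.pos i + (PV.pos a + d)              ≡⟨ cong (PW.pos i +_) (+-comm (PV.pos a) d) ⟩
        PW.pos i + (d + PV.pos a)              ≡⟨ +-assoc (PW.pos i) d _ ⟨
        PW.pos i + d + PV.pos a                ∎)
      period : PW.pos (j + q) ≡ PW.pos j + d
      period = +-cancelʳ-≡ (PW.pos i) _ _ (begin-equality
        PW.pos (j + q) + PW.pos i    ≡⟨ PW.pos-shift j≤i repˡ ⟨
        PW.pos (i + q) + PW.pos j    ≡⟨ cong (_+ PW.pos j) period′ ⟩
        PW.pos i + d + PW.pos j      ≡⟨ +-comm (PW.pos i + d) _ ⟩
        PW.pos j + (PW.pos i + d)    ≡⟨ cong (PW.pos j +_) (+-comm (PW.pos i) d) ⟩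
        PW.pos j + (d + PW.pos i)    ≡⟨ +-assoc (PW.pos j) d _ ⟨
        PW.pos j + d + PW.pos i      ∎)

occurs-++⁻ʳ : ∀ (v : InfWord A) {i} xs {ys} → Occurs v i (xs ++ ys) → Occurs v (i + length xs) ys
occurs-++⁻ʳ v {i} []       {ys} p       = subst (λ j → Occurs v j ys) (sym (+-identityʳ i)) p
occurs-++⁻ʳ v {i} (x ∷ xs) {ys} (_ , p) =
  subst (λ j → Occurs v j ys) (sym (+-suc i (length xs))) (occurs-++⁻ʳ v xs p)

occurs-shift : ∀ (u v : InfWord A) {c} → (∀ k → v (c + k) ≡ u k) →
               ∀ {i} xs → Occurs u i xs → Occurs v (c + i) xs
occurs-shift u v         eq     []       _       = tt
occurs-shift u v {c = c} eq {i} (x ∷ xs) (p , q) = trans (eq i) p ,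
  subst (λ j → Occurs v j xs) (+-suc c i) (occurs-shift u v eq xs q)

++-injectiveˡ : ∀ (xs xs′ : List A) {ys ys′} → length xs ≡ length xs′ → xs ++ ys ≡ xs′ ++ ys′ → xs ≡ xs′
++-injectiveˡ []       []         _   _  = refl
++-injectiveˡ (x ∷ xs) (x′ ∷ xs′) len eq with refl , eq′ ← ∷-injective eq =
  cong (x ∷_) (++-injectiveˡ xs xs′ (suc-injective len) eq′)

-- Images of infinite words

⟨⟩-snoc : ∀ (f : Morphism A B) w i →
          f ⟨ applyUpTo w (suc i) ⟩ ≡ f ⟨ applyUpTo w i ⟩ ++ toList (f (w i))
⟨⟩-snoc f w i = begin
  f ⟨ applyUpTo w (suc i) ⟩                       ≡⟨ cong (f ⟨_⟩) (applyUpTo-∷ʳ w i) ⟨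
  f ⟨ applyUpTo w i ++ [ w i ] ⟩                  ≡⟨ concatMap-++ (toList ∘ f) (applyUpTo w i) [ w i ] ⟩
  f ⟨ applyUpTo w i ⟩ ++ (toList (f (w i)) ++ []) ≡⟨ cong (f ⟨ applyUpTo w i ⟩ ++_) (++-identityʳ _) ⟩
  f ⟨ applyUpTo w i ⟩ ++ toList (f (w i))         ∎
  where open ≡-Reasoning

length-image : ∀ (f : Morphism A B) w i → length (f ⟨ applyUpTo w i ⟩) ≡ cut f w i
length-image f w zero    = refl
length-image f w (suc i) = begin
  length (f ⟨ applyUpTo w (suc i) ⟩)                    ≡⟨ cong length (⟨⟩-snoc f w i) ⟩
  length (f ⟨ applyUpTo w i ⟩ ++ toList (f (w i)))      ≡⟨ length-++ (f ⟨ applyUpTo w i ⟩) ⟩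
  length (f ⟨ applyUpTo w i ⟩) + ∣ f (w i) ∣            ≡⟨ cong (_+ ∣ f (w i) ∣) (length-image f w i) ⟩
  cut f w (suc i)                                       ∎
  where open ≡-Reasoning

-- For large n, the image of a prefix of `w` and the prefix of `w` of the same length are both
-- prefixes of fⁿ⁺¹(a), hence equal.
limit-fixed : ∀ (f : Morphism A A) (a : A) (w : InfWord A) → w IsLimitOf iterates f a →
              ∀ i → Occurs w (cut f w i) (toList (f (w i)))
limit-fixed f a w limit i = subst (λ c → Occurs w c (toList (f (w i)))) (length-image f w i)
  (occurs-++⁻ʳ w (f ⟨ applyUpTo w i ⟩) (subst (Occurs w 0) (⟨⟩-snoc f w i) occurs-f⟨u⟩))
  where
  u : List _
  u = applyUpTo w (suc i)
  k : ℕ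
  k = length (f ⟨ u ⟩)
  f⟨u⟩≡ : f ⟨ u ⟩ ≡ applyUpTo w k
  f⟨u⟩≡ with N , pre ← limit (suc i) | M , pre′ ← limit k
    with zs , eq ← pre (N ⊔ M) (m≤m⊔n N M) | zs′ , eq′ ← pre′ (suc (N ⊔ M)) (m≤n⇒m≤1+n (m≤n⊔m N M)) =
    ++-injectiveˡ (f ⟨ u ⟩) (applyUpTo w k) (sym (length-applyUpTo w k))
      (trans (sym (concatMap-++ (toList ∘ f) u zs)) (trans (cong (f ⟨_⟩) (sym eq)) eq′))
  occurs-f⟨u⟩ : Occurs w 0 (f ⟨ u ⟩)
  occurs-f⟨u⟩ = subst (Occurs w 0) (sym f⟨u⟩≡) (occurs-applyUpTo w 0 k)

-- Concat∞.go has a second, unused alphabet argument, which cannot be inferred.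
prepend : List A → (ℕ → List⁺ A) → InfWord A
prepend {A} = Concat∞.go {A}

prepend-skip : ∀ (xs : List A) s k → prepend xs s (length xs + k) ≡ concat∞ s k
prepend-skip []       s k = refl
prepend-skip (x ∷ xs) s k = prepend-skip xs s k

prepend-occurs : ∀ (xs : List A) s → Occurs (prepend xs s) 0 xs
prepend-occurs []       s = tt
prepend-occurs (x ∷ xs) s = refl , occurs-shift (prepend xs s) (prepend (x ∷ xs) s) {1} (λ _ → refl) xs (prepend-occurs xs s)

concat∞-skip : ∀ (s : ℕ → List⁺ A) k → concat∞ s (∣ s 0 ∣ + k) ≡ concat∞ (s ∘ suc) k
concat∞-skip s k = prepend-skip (List⁺.tail (s 0)) (s ∘ suc) k

cut-suc : ∀ (f : Morphism A B) w i → cut f w (suc i) ≡ ∣ f (w 0) ∣ + cut f (w ∘ suc) i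
cut-suc f w zero    = sym (+-identityʳ _)
cut-suc f w (suc i) = trans (cong (_+ ∣ f (w (suc i)) ∣) (cut-suc f w i))
                            (+-assoc ∣ f (w 0) ∣ (cut f (w ∘ suc) i) _)

image-occurs : ∀ (f : Morphism A B) w i → Occurs (f ⟨ w ⟩∞) (cut f w i) (toList (f (w i)))
image-occurs f w zero =
  refl , occurs-shift (prepend (List⁺.tail (f (w 0))) (f ∘ w ∘ suc)) (f ⟨ w ⟩∞) {1} (λ _ → refl)
           (List⁺.tail (f (w 0))) (prepend-occurs (List⁺.tail (f (w 0))) (f ∘ w ∘ suc))
image-occurs f w (suc i) = subst (λ c → Occurs (f ⟨ w ⟩∞) c (toList (f (w (suc i))))) (sym (cut-suc f w i))
  (occurs-shift (f ⟨ w ∘ suc ⟩∞) (f ⟨ w ⟩∞) (concat∞-skip (f ∘ w)) (toList (f (w (suc i))))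
    (image-occurs f (w ∘ suc) i))

-- Factors of a fixed point.

cut-growth : ∀ (f : Morphism A B) w → (∀ a → 2 ≤ ∣ f a ∣) → ∀ i q → cut f w i + 2 * q ≤ cut f w (i + q)
cut-growth f w 2≤ i zero    rewrite +-identityʳ i = ≤-reflexive (+-identityʳ _)
cut-growth f w 2≤ i (suc q) = begin
  cut f w i + 2 * suc q        ≡⟨ cong (cut f w i +_) (*-suc 2 q) ⟩
  cut f w i + (2 + 2 * q)      ≡⟨ cong (cut f w i +_) (+-comm 2 (2 * q)) ⟩
  cut f w i + (2 * q + 2)      ≡⟨ +-assoc (cut f w i) (2 * q) 2 ⟨
  cut f w i + 2 * q + 2        ≤⟨ +-mono-≤ (cut-growth f w 2≤ i q) (2≤ (w (i + q))) ⟩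
  cut f w (suc (i + q))        ≡⟨ cong (cut f w) (+-suc i q) ⟨
  cut f w (i + suc q)          ∎
  where open ≤-Reasoning

2*-strict : ∀ {q} → 0 < q → q < 2 * q
2*-strict {q} 0<q = m<m+n q (≤-trans 0<q (m≤m+n q 0))

-- Images have at least two letters, so a position k > 0 lies in the image of a letter at some i <
-- k. Expanding the listed word at i yields a word at k, which has a listed prefix by `closed`.
covers-fixed : ∀ (f : Morphism A A) w (image : ∀ i → Occurs w (cut f w i) (toList (f (w i)))) →
               (∀ a → 2 ≤ ∣ f a ∣) → ∀ {uss u} → u ∈ uss → Occurs w 0 u →
               All (λ x → Any (λ u → Prefix _≡_ u x) uss) (expand f uss) → Covers w uss
covers-fixed f w image 2≤ {uss} {u} u∈ occ closed = <-rec (λ k → ∃[ u ] u ∈ uss × Occurs w k u) step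
  where
  open Image f w w image
  step : ∀ k → (∀ {i} → i < k → ∃[ u ] u ∈ uss × Occurs w i u) → ∃[ u ] u ∈ uss × Occurs w k u
  i< : ∀ {k} i s → suc k ≡ cut f w i + s → i < suc k
  i<     zero    s eq = z<s
  i< {k} (suc i) s eq = begin-strict
    suc i               <⟨ 2*-strict z<s ⟩
    2 * suc i           ≤⟨ cut-growth f w 2≤ 0 (suc i) ⟩
    cut f w (suc i)     ≤⟨ m≤m+n _ s ⟩
    cut f w (suc i) + s ≡⟨ eq ⟨
    suc k               ∎
    where open ≤-Reasoning
  step zero    _   = u , u∈ , occ
  step (suc k) rec
    with i , s , s< , eq ← locate (suc k)
    with us , us∈ , occ-us ← rec (i< i s eq)
    with x , x∈ , occ-x ← occurs-expand us occ-us s<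
    with u′ , u′∈ , pre ← find (All.lookup closed
           (∈-concatMap⁺ (expandWord f) (Any.map (λ { refl → x∈ }) us∈)))
    = u′ , u′∈ , occurs-prefix w pre (subst (λ c → Occurs w c x) (sym eq) occ-x)

-- Weights, tests and finite checks for g and h.

gWeights : Weights 3
gWeights = record
  { mass = λ _ → 0 , 1
  ; right = λ _ _ → 0 , 0
  ; left = λ _ _ → 0 , 0
  ; right-diagonal = λ _ → refl
  ; left-diagonal = λ _ → refl
  }

-- At t = (6ᵏ - 1) / 5, the mass of a is |g(hᵏ(a))|: the image under h replaces t
-- by 6 t + 1.  The slopes are 11 times (4 , 1 , 4 , 5), the left eigenvector of
-- the incidence matrix of h for the eigenvalue 6.
hMass : Fin 4 → Affine
hMass 0F = 44 , 7
hMass 1F = 11 , 4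
hMass 2F = 44 , 7
hMass 3F = 55 , 11

-- The constants are the longest common extensions of g(a ⋯) and g(b ⋯); the
-- slopes are the least integers that are preserved when passing to the mismatch
-- of h(a ⋯) and h(b ⋯), which runs through the cycle 01 → 03 → 23 → 01.  In hLeft
-- the same is done with common suffixes.
hRight : Fin 4 → Fin 4 → Affine
hRight 0F 0F = 0 , 0
hRight 1F 1F = 0 , 0
hRight 2F 2F = 0 , 0
hRight 3F 3F = 0 , 0
hRight 0F 3F = 40 , 7
hRight 3F 0F = 40 , 7
hRight 0F 2F = 18 , 2
hRight 2F 0F = 18 , 2
hRight 2F 3F = 18 , 2
hRight 3F 2F = 18 , 2
hRight _  _  = 7 , 1

hLeft : Fin 4 → Fin 4 → Affine
hLeft 0F 0F = 0 , 0
hLeft 1F 1F = 0 , 0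
hLeft 2F 2F = 0 , 0
hLeft 3F 3F = 0 , 0
hLeft 2F 3F = 33 , 8
hLeft 3F 2F = 33 , 8
hLeft 1F _  = 0 , 2
hLeft _  1F = 0 , 2
hLeft _  _  = 11 , 3

hWeights : Weights 4
hWeights = record
  { mass = hMass
  ; right = hRight
  ; left = hLeft
  ; right-diagonal = λ { 0F → refl ; 1F → refl ; 2F → refl ; 3F → refl }
  ; left-diagonal = λ { 0F → refl ; 1F → refl ; 2F → refl ; 3F → refl }
  }

-- In g(w), a block ends precisely after a factor 12 followed by 0.
gTest : Fin 3 → Fin 3 → Fin 3 → Fin 3 → Bool
gTest 1F 2F 0F _ = true
gTest _  _  _  _ = false

-- In h(w), a block starts precisely at a factor 012 not preceded by 3, and
-- between the letters of a factor 23.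
hTest : Fin 4 → Fin 4 → Fin 4 → Fin 4 → Bool
hTest 3F 0F _  _  = false
hTest _  0F 1F 2F = true
hTest 2F 3F _  _  = true
hTest _  _  _  _  = false

-- Length 3 suffices: even after the last letter of a block, the next two blocks supply at least
-- four letters, enough for another factor of length 3 and for a test window.
factors₃ : List (List (Fin 4))
factors₃ =
  (0F ∷ 1F ∷ 2F ∷ []) ∷ (0F ∷ 1F ∷ 3F ∷ []) ∷ (1F ∷ 0F ∷ 1F ∷ []) ∷ (1F ∷ 2F ∷ 0F ∷ []) ∷
  (1F ∷ 2F ∷ 1F ∷ []) ∷ (1F ∷ 2F ∷ 3F ∷ []) ∷ (1F ∷ 3F ∷ 0F ∷ []) ∷ (1F ∷ 3F ∷ 1F ∷ []) ∷
  (2F ∷ 0F ∷ 1F ∷ []) ∷ (2F ∷ 1F ∷ 3F ∷ []) ∷ (2F ∷ 3F ∷ 1F ∷ []) ∷ (3F ∷ 0F ∷ 1F ∷ []) ∷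
  (3F ∷ 1F ∷ 0F ∷ []) ∷ (3F ∷ 1F ∷ 2F ∷ []) ∷ []

hRight≤ : ∀ x y → T (hRight x y ≤ᴬ (40 , 7))
hRight≤ = toWitness {a? = Fin.all? λ x → Fin.all? λ y → T? (hRight x y ≤ᴬ (40 , 7))} tt

hLeft≤ : ∀ x y → T (hLeft x y ≤ᴬ (33 , 8))
hLeft≤ = toWitness {a? = Fin.all? λ x → Fin.all? λ y → T? (hLeft x y ≤ᴬ (33 , 8))} tt

0≤ᴬ0 : ∀ {n} → Fin n → Fin n → T ((0 , 0) ≤ᴬ (0 , 0))
0≤ᴬ0 _ _ = tt

-- 12 and 13 are one less than 3 + 10 and 3 + 11, the lengths from which `synchronise` applies to h
-- and g. Beyond the periods 17 and 15 the crude estimate is enough; for g, 22 · 13 = 286 exceeds 19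
-- · 15 = 285 but not 19 · 16 = 304.
module hShort = ShortFactors hWeights (40 , 7) (33 , 8) hRight≤ hLeft≤ 12 17
module gShort = ShortFactors gWeights (0 , 0) (0 , 0) 0≤ᴬ0 0≤ᴬ0 13 15

module hSync = Synchronisation h hTest 0
module gSync = Synchronisation g gTest 1

h-recognised : T (all hSync.recognised factors₃)
h-recognised = tt

g-recognised : T (all gSync.recognised factors₃)
g-recognised = tt

-- Expanding twice makes the words long enough to show, for every period up to 17, a mismatch that
-- ends the repetition.
h-boundedShort : T (all hShort.boundedShort (expand h (expand h factors₃)))
h-boundedShort = tt

g-boundedShort : T (all gShort.boundedShort (expand g (expand h factors₃)))
g-boundedShort = tt

factors₃-closed : All (λ x → Any (λ u → Prefix _≡_ u x) factors₃) (expand h factors₃)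
factors₃-closed = toWitness {a? = All.all? (λ x → Any.any? (λ u → prefix? Fin._≟_ u x) factors₃) (expand h factors₃)} tt

-- The effect on affine functions of replacing t by 6 t + 1, and by 0.
hPull gPull : Affine → Affine
hPull (s , c) = 6 * s , s + c
gPull (s , c) = 0 , c

eval-hPull : ∀ t x → eval t (hPull x) ≡ eval (suc (6 * t)) x
eval-hPull t (s , c) = identity t s c
  where
  identity : ∀ t s c → 6 * s * t + (s + c) ≡ s * suc (6 * t) + c
  identity = solve-∀

eval-gPull : ∀ x → eval 0 (gPull x) ≡ eval 0 x
eval-gPull (s , c) = cong (_+ c) (sym (*-zeroʳ s))

-- The images of distinct letters under h mismatch from both ends. But g(0) is a prefix of g(3), and
-- g(2) is a suffix of g(3), so their mismatches lie in the neighbouring blocks; every block of g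
-- begins with 0 and ends with 12.
module hDescent = Descent h hWeights hWeights hPull [] []
module gDescent = Descent g gWeights hWeights gPull (0F ∷ []) (2F ∷ 1F ∷ [])

-- The constants say that the slope of a is |g(h(a))| - |g(a)|, the slopes that these differences
-- form an eigenvector for 6. Hence |g(hᵏ(a))| is affine in 6ᵏ.
h-total-mass : ∀ a → total hMass (toList (h a)) ≡ hPull (hMass a)
h-total-mass = λ { 0F → refl ; 1F → refl ; 2F → refl ; 3F → refl }

g-total-mass : ∀ a → total (Weights.mass gWeights) (toList (g a)) ≡ gPull (hMass a)
g-total-mass = λ { 0F → refl ; 1F → refl ; 2F → refl ; 3F → refl }

distinct : ∀ {n} (f : Fin n → Fin n → Bool) → (∀ a b → a ≡ b ⊎ T (f a b)) → ∀ a b → a ≢ b → T (f a b)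
distinct f ok a b a≢b with ok a b
... | inj₁ a≡b = contradiction a≡b a≢b
... | inj₂ fab = fab

h-dominates : ∀ a b → a ≢ b → T (hDescent.dominated a b)
h-dominates = distinct hDescent.dominated
  (toWitness {a? = Fin.all? λ a → Fin.all? λ b → (a Fin.≟ b) ⊎-dec T? (hDescent.dominated a b)} tt)

g-dominates : ∀ a b → a ≢ b → T (gDescent.dominated a b)
g-dominates = distinct gDescent.dominated
  (toWitness {a? = Fin.all? λ a → Fin.all? λ b → (a Fin.≟ b) ⊎-dec T? (gDescent.dominated a b)} tt)

-- This is 12 g(31231) 01. The factor 31231 of h²(0) has period 3, which becomes |g(312)| = 22. It
-- stands between the mismatches (1 , 2) and (0 , 2), whose images share the suffix 2 12 only in its
-- last two letters 12 and the prefix 01, so r = 2 + |g(31)| + 2 = 19.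
extremal : List (Fin 3)
extremal = take 41 (drop 93 (g ⟨ h ⟨ h ⟨ [ 0F ] ⟩ ⟩ ⟩))

extremalPeriod : List⁺ (Fin 3)
extremalPeriod = 1F ∷ 2F ∷ 0F ∷ 1F ∷ 0F ∷ 2F ∷ 0F ∷ 1F ∷ 2F ∷ 1F ∷ 0F ∷ 1F ∷ 2F ∷ 0F ∷ 2F ∷ 1F ∷ 2F ∷ 0F ∷ 1F ∷ 2F ∷ 1F ∷ 0F ∷ []

-- Bounds for repetitions in the two words.

module Word (w : InfWord (Fin 4)) (image-h : ∀ i → Occurs w (cut h w i) (toList (h (w i))))
  (w₀ : w 0 ≡ 0F) (v : InfWord (Fin 3)) (image-g : ∀ i → Occurs v (cut g w i) (toList (g (w i)))) where

  private
    module HH = Image h w w image-h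
    module HG = Image g w v image-g

  hLength : ∀ a → 2 ≤ ∣ h a ∣ × ∣ h a ∣ ≤ 10
  hLength = toWitness {a? = Fin.all? λ a → (2 ≤? ∣ h a ∣) ×-dec (∣ h a ∣ ≤? 10)} tt

  gLength : ∀ a → 2 ≤ ∣ g a ∣ × ∣ g a ∣ ≤ 11
  gLength = toWitness {a? = Fin.all? λ a → (2 ≤? ∣ g a ∣) ×-dec (∣ g a ∣ ≤? 11)} tt

  occurs-h² : Occurs w 0 (h ⟨ h ⟨ [ 0F ] ⟩ ⟩)
  occurs-h² = HH.occurs-image (h ⟨ [ 0F ] ⟩) (HH.occurs-image [ 0F ] (w₀ , tt))

  covers₃ : Covers w factors₃
  covers₃ = covers-fixed h w image-h (proj₁ ∘ hLength) {factors₃} {0F ∷ 1F ∷ 2F ∷ []} (here refl)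
    (occurs-take w 3 (h ⟨ h ⟨ [ 0F ] ⟩ ⟩) occurs-h²) factors₃-closed

  covers₁₁ : Covers w (expand h factors₃)
  covers₁₁ = HH.covers-expand covers₃

  bounded-w-short : ∀ t {a b p} → a ≤ b → b ≤ a + 12 → Repeats w a b p → 0 < p →
                    Bounds.Bounded w hWeights t a b p
  -- `1F` is a dummy for the missing letter before position 0; its left weights have slope 0.
  bounded-w-short t = hShort.bounded-covered (m≤m+n 12 5) w t {l = 1F} {h ⟨ h ⟨ [ 0F ] ⟩ ⟩}
    (HH.covers-expand covers₁₁) h-boundedShort occurs-h² tt

  bounded-v-short : ∀ t {a b p} → a ≤ b → b ≤ a + 13 → Repeats v a b p → 0 < p →
                    Bounds.Bounded v gWeights t a b p
  bounded-v-short t = gShort.bounded-covered (m≤m+n 13 2) v t {l = 1F} {g ⟨ h ⟨ h ⟨ [ 0F ] ⟩ ⟩ ⟩}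
    (HG.covers-expand covers₁₁) g-boundedShort (HG.occurs-image (h ⟨ h ⟨ [ 0F ] ⟩ ⟩) occurs-h²) tt

  -- `t` is quantified inside the induction on `p`, because the hypothesis is applied at 6 t + 1. As
  -- blocks have at least two letters, the period is at least halved.
  bounded-w : ∀ p → 0 < p → ∀ t {a b} → a ≤ b → Repeats w a b p → Bounds.Bounded w hWeights t a b p
  bounded-w = <-rec (λ p → 0 < p → ∀ t {a b} → a ≤ b → Repeats w a b p → Bounds.Bounded w hWeights t a b p) step
    where
    step : ∀ p → (∀ {q} → q < p → 0 < q → ∀ t {a b} → a ≤ b → Repeats w a b q → Bounds.Bounded w hWeights t a b q) →
           0 < p → ∀ t {a b} → a ≤ b → Repeats w a b p → Bounds.Bounded w hWeights t a b p
    step p rec 0<p t {a} {b} a≤b rep with a + 13 ≤? b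
    ... | no  a+13≰b = bounded-w-short t a≤b (s≤s⁻¹ (≤-trans (≰⇒> a+13≰b) (≤-reflexive (+-suc a 12)))) rep 0<p
    ... | yes a+13≤b = desubstitute
      (hSync.synchronise w w image-h covers₃ h-recognised 10
        (≤-trans (s≤s z≤n) ∘ proj₁ ∘ hLength) (proj₂ ∘ hLength) z≤n 0<p a+13≤b rep)
      where
      open ≤-Reasoning
      shorter : ∀ i {q} → 0 < q → cut h w (i + q) ≡ cut h w i + p → q < p
      shorter i {q} 0<q cut≡ = <-≤-trans (2*-strict 0<q) (+-cancelˡ-≤ (cut h w i) _ _ (begin
        cut h w i + 2 * q   ≤⟨ cut-growth h w (proj₁ ∘ hLength) i q ⟩
        cut h w (i + q)     ≡⟨ cut≡ ⟩
        cut h w i + p       ∎))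
      desubstitute : (∃₂ λ i q → 0 < q × a ≤ cut h w i × cut h w i ≤ b × cut h w (i + q) ≡ cut h w i + p) →
                     Bounds.Bounded w hWeights t a b p
      desubstitute (i , q , 0<q , a≤c , c≤b , cut≡) =
        hDescent.bounded-image w w image-h t (suc (6 * t)) (eval-hPull t)
          h-total-mass h-dominates (λ _ → tt) (λ _ → tt) {a} {b} {p} {i} {q} a≤c c≤b cut≡ rep
          (λ {j} {k} j≤k rep′ → rec {q} (shorter i 0<q cut≡) 0<q (suc (6 * t)) {j} {k} j≤k rep′)

  v-followed : ∀ i → Occurs v (cut g w i) [ 0F ]
  v-followed i with w i | image-g i
  ... | 0F | eq , _ = eq , tt
  ... | 1F | eq , _ = eq , tt
  ... | 2F | eq , _ = eq , tt
  ... | 3F | eq , _ = eq , tt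

  v-preceded : ∀ i → Precedes v (cut g w i) (2F ∷ 1F ∷ [])
  v-preceded zero = tt
  v-preceded (suc i) = ends (w i) (precedes-ʳ++ v (toList (g (w i))) {[]} (image-g i) tt)
    where
    ends : ∀ {c} a → Precedes v (c + ∣ g a ∣) (toList (g a) ʳ++ []) → Precedes v (c + ∣ g a ∣) (2F ∷ 1F ∷ [])
    ends {c} 0F p rewrite +-comm c 7  = proj₁ p , proj₁ (proj₂ p) , tt
    ends {c} 1F p rewrite +-comm c 4  = proj₁ p , proj₁ (proj₂ p) , tt
    ends {c} 2F p rewrite +-comm c 7  = proj₁ p , proj₁ (proj₂ p) , tt
    ends {c} 3F p rewrite +-comm c 11 = proj₁ p , proj₁ (proj₂ p) , tt

  -- A single desubstitution under g leads to `bounded-w` at t = 0, where the mass of a letter a is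
  -- |g(a)|.
  bounded-v : ∀ {a b p} → 0 < p → a ≤ b → Repeats v a b p → Bounds.Bounded v gWeights 0 a b p
  bounded-v {a} {b} {p} 0<p a≤b rep with a + 14 ≤? b
  ... | no  a+14≰b = bounded-v-short 0 a≤b (s≤s⁻¹ (≤-trans (≰⇒> a+14≰b) (≤-reflexive (+-suc a 13)))) rep 0<p
  ... | yes a+14≤b = desubstitute
    (gSync.synchronise w v image-g covers₃ g-recognised 11
      (proj₁ ∘ gLength) (proj₂ ∘ gLength) (s≤s z≤n) 0<p a+14≤b rep)
    where
    desubstitute : (∃₂ λ i q → 0 < q × a ≤ cut g w i × cut g w i ≤ b × cut g w (i + q) ≡ cut g w i + p) →
                   Bounds.Bounded v gWeights 0 a b p
    desubstitute (i , q , 0<q , a≤c , c≤b , cut≡) =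
      gDescent.bounded-image w v image-g 0 0 eval-gPull g-total-mass g-dominates
        v-followed v-preceded {a} {b} {p} {i} {q} a≤c c≤b cut≡ rep (λ {j} {k} j≤k rep′ → bounded-w q 0<q 0 {j} {k} j≤k rep′)

  pos-v : ∀ i → Measure.pos v (Weights.mass gWeights) 0 i ≡ i
  pos-v zero    = refl
  pos-v (suc i) = trans (cong (_+ 1) (pos-v i)) (+-comm i 1)

  repetition-bound : ∀ {a r p} → 0 < p → Repeats v a (a + r) p → 22 * r ≤ 19 * p
  repetition-bound {a} {r} {p} 0<p rep = +-cancelˡ-≤ (22 * a) _ _ (begin
    22 * a + 22 * r               ≡⟨ *-distribˡ-+ 22 a r ⟨
    22 * (a + r)                  ≡⟨ cong (22 *_) (pos-v (a + r)) ⟨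
    22 * pos (a + r)              ≤⟨ *-monoʳ-≤ 22 (m≤m+n (pos (a + r)) (Bounds.excess v gWeights 0 a (a + r) p)) ⟩
    22 * (pos (a + r) + Bounds.excess v gWeights 0 a (a + r) p)
                                  ≤⟨ bounded-v {a} {a + r} {p} 0<p (m≤m+n a r) rep p (trans (pos-v (a + p)) (cong (_+ p) (sym (pos-v a)))) ⟩
    22 * pos a + 19 * p           ≡⟨ cong (λ z → 22 * z + 19 * p) (pos-v a) ⟩
    22 * a + 19 * p               ∎)
    where
    open ≤-Reasoning
    open Measure v (Weights.mass gWeights) 0

  extremal-factor : IsFactor extremal v
  extremal-factor = 93 , occurs⇒isPrefix v extremal (occurs-take v 41 (drop 93 word) (occurs-drop v 93 word occurs-word))
    where
    word : List (Fin 3)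
    word = g ⟨ h ⟨ h ⟨ [ 0F ] ⟩ ⟩ ⟩
    occurs-word : Occurs v 0 word
    occurs-word = HG.occurs-image (h ⟨ h ⟨ [ 0F ] ⟩ ⟩) occurs-h²

-- From repetitions to exponents.

isPrefix-lookup : ∀ {u v : InfWord A} xs → IsPrefix xs u → IsPrefix xs v → ∀ k → k < length xs → u k ≡ v k
isPrefix-lookup {u = u} {v} (x ∷ xs) p q k k<
  with refl , p′ ← ∷-injective p | q₀ , q′ ← ∷-injective q with k | k<
... | zero  | _       = q₀
... | suc k | s≤s k<′ = isPrefix-lookup xs p′ q′ k k<′

power-bound : ∀ (w : InfWord A) → (∀ {a r p} → 0 < p → Repeats w a (a + r) p → 22 * r ≤ 19 * p) →
              ∀ u xs → IsPrefix xs (u ^∞) → IsFactor xs w → length xs * 22 ≤ 41 * ∣ u ∣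
power-bound w bound u xs prefix (i , occ) with ∣ u ∣ ≤? length xs
... | no  u≰xs = begin
  length xs * 22    ≡⟨ *-comm (length xs) 22 ⟩
  -- The exponent is below 1 here, so 22 ≤ 41 is enough.
  22 * length xs    ≤⟨ *-mono-≤ (m≤m+n 22 19) (<⇒≤ (≰⇒> u≰xs)) ⟩
  41 * ∣ u ∣        ∎
  where open ≤-Reasoning
... | yes u≤xs with r , len≡ ← m≤n⇒∃[o]m+o≡n u≤xs = begin
  length xs * 22            ≡⟨ *-comm (length xs) 22 ⟩
  22 * length xs            ≡⟨ cong (22 *_) len≡ ⟨
  22 * (∣ u ∣ + r)          ≡⟨ *-distribˡ-+ 22 ∣ u ∣ r ⟩
  22 * ∣ u ∣ + 22 * r       ≤⟨ +-monoʳ-≤ (22 * ∣ u ∣) (bound {a = i} z<s repeats) ⟩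
  22 * ∣ u ∣ + 19 * ∣ u ∣   ≡⟨ *-distribʳ-+ ∣ u ∣ 22 19 ⟨
  41 * ∣ u ∣                ∎
  where
  open ≤-Reasoning
  letter : ∀ k → k < length xs → w (i + k) ≡ (u ^∞) k
  letter = isPrefix-lookup {u = λ k → w (i + k)} {v = u ^∞} xs occ prefix
  repeats : Repeats w i (i + r) ∣ u ∣
  repeats k i≤k k<i+r with s , refl ← m≤n⇒∃[o]m+o≡n i≤k =
    trans (letter s (≤-trans s<r (≤-trans (m≤n+m r ∣ u ∣) (≤-reflexive len≡))))
      (trans (sym (concat∞-skip (const u) s))
        (trans (sym (letter (∣ u ∣ + s) (<-≤-trans (+-monoʳ-< ∣ u ∣ s<r) (≤-reflexive len≡))))
          (cong w (trans (cong (i +_) (+-comm ∣ u ∣ s)) (sym (+-assoc i s ∣ u ∣))))))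
    where
    s<r : s < r
    s<r = +-cancelˡ-< i s r k<i+r

-- `/` reduces to lowest terms, so the cross-multiplied inequality is used on unnormalised
-- fractions.
/-mono-≤ : ∀ m n m′ n′ .{{_ : NonZero n}} .{{_ : NonZero n′}} → m * n′ ≤ m′ * n →
           (ℤ.+ m) ℚ./ n ℚ.≤ (ℤ.+ m′) ℚ./ n′
/-mono-≤ m (suc n) m′ (suc n′) le = ℚ.toℚᵘ-cancel-≤ (begin
  ℚ.toℚᵘ (ℚ.fromℚᵘ (ℚᵘ.mkℚᵘ (ℤ.+ m) n))     ≃⟨ ℚ.toℚᵘ-fromℚᵘ (ℚᵘ.mkℚᵘ (ℤ.+ m) n) ⟩
  ℚᵘ.mkℚᵘ (ℤ.+ m) n                         ≤⟨ ℚᵘ.*≤* (subst₂ ℤ._≤_ (ℤ.pos-* m (suc n′)) (ℤ.pos-* m′ (suc n)) (ℤ.+≤+ le)) ⟩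
  ℚᵘ.mkℚᵘ (ℤ.+ m′) n′                       ≃⟨ ℚ.toℚᵘ-fromℚᵘ (ℚᵘ.mkℚᵘ (ℤ.+ m′) n′) ⟨
  ℚ.toℚᵘ (ℚ.fromℚᵘ (ℚᵘ.mkℚᵘ (ℤ.+ m′) n′))   ∎)
  where open ℚᵘ.≤-Reasoning

h-image : ∀ i → Occurs h^ω0 (cut h h^ω0 i) (toList (h (h^ω0 i)))
h-image = limit-fixed h 0F h^ω0 (iterate-limit-isLimit h 0F h-prolongable)

open import Data.Integer.Base using (+_)
open import Data.Rational.Base using (_/_)

theorem14 : IsCriticalExponent (g ⟨ h^ω0 ⟩∞) (+ 41 / 22)
theorem14 =
    (λ { _ (u , xs , (prefix , refl) , factor) →
         /-mono-≤ (length xs) ∣ u ∣ 41 22 (power-bound (g ⟨ h^ω0 ⟩∞) W.repetition-bound u xs prefix factor) })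
  -- The supremum is attained, so an upper bound is simply applied to `extremal`; its period and its
  -- exponent are verified by evaluation.
  , (λ _ bound → bound (+ 41 / 22) (extremalPeriod , extremal , (refl , refl) , W.extremal-factor))
  where
  module W = Word h^ω0 h-image refl (g ⟨ h^ω0 ⟩∞) (image-occurs g h^ω0)
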